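{- Let $G$ be a graph with $m\ge 1$ edges, let $M_2=4I+B$ where $B$ is the adjacency matrix of the line graph of $G$, let $f(\mathbf{w})=\mathbf{w}^\top M_2\mathbf{w}$, and let $R=\{\mathbf{w}\in\mathbb{R}^{E(G)}:\mathbf{1}^\top\mathbf{w}=m,\ \mathbf{w}\ge 0 \text{ entrywise}\}$. Let $(\mathbf{w}_n)_{n\ge 0}$ be any sequence generated by the following procedure: $\mathbf{w}_0=\mathbf{1}$; given $\mathbf{w}_n$, let $i$ be an index at which $M_2\mathbf{w}_n$ has its minimum entry; for each index $j\in E(G)$ set $$t_j=\frac{(M_2\mathbf{w}_n)_j-(M_2\mathbf{w}_n)_i}{8},\qquad \eta_j=\min\{t_j,(\mathbf{w}_n)_j\};$$ choose $j$ such that $\eta_j$ is maximized, and set $\mathbf{w}_{n+1}=\mathbf{w}_n+\eta_j(\mathbf{e}_i-\mathbf{e}_j)$. Then $(\mathbf{w}_n)$ converges to the minimizer of $f$ over $R$.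
   Context: Graphs are finite and simple. The line graph of $G$ has vertex set $E(G)$, two distinct edges being adjacent when they share a vertex. $\mathbf{1}$ is the all-ones vector and $\mathbf{e}_i$ the $i$-th standard basis vector of $\mathbb{R}^{E(G)}$. The matrix $M_2$ is positive definite, so $f$ has a unique minimizer on the compact convex set $R$. -}

module Defs where

open import Level using (0ℓ)
open import Data.Nat as ℕ using (ℕ; suc)
import Data.Nat.Properties as ℕP
open import Data.Fin as Fin using (Fin)
import Data.Fin.Properties as FinP
open import Data.Integer using (+_)
open import Data.Rational as ℚ using (ℚ; 0ℚ; 1ℚ)
import Data.Rational.Properties as ℚP
open import Data.Rational.Solver using (module +-*-Solver)
open import Data.List as List using (List)
open import Data.Vec.Functional as Vector using (Vector)
open import Data.Product using (∃; _×_; _,_; proj₁; proj₂)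
open import Data.Sum using (_⊎_; inj₁; inj₂)
open import Relation.Nullary using (Dec; does)
open import Relation.Nullary.Decidable using (_×-dec_; _⊎-dec_; ¬?)
open import Relation.Binary using (Rel; Decidable; Symmetric; Irreflexive)
open import Relation.Binary.PropositionalEquality
  using (_≡_; _≢_; refl; sym; trans; cong; subst)
open import Data.Bool using (if_then_else_)

Cauchy : (ℕ → ℚ) → Set
Cauchy s = ∀ ε → 0ℚ ℚ.< ε →
  ∃ λ N → ∀ m n → N ℕ.≤ m → N ℕ.≤ n → ℚ.∣ s m ℚ.- s n ∣ ℚ.< ε

-- A real is a Cauchy sequence of rationals; equality of reals is _≈_ below,
-- not _≡_.
record ℝ : Set where
  no-eta-equality
  constructor mkℝ
  field
    seq    : ℕ → ℚ
    cauchy : Cauchy seq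

open ℝ public

module CauchyClosure where
  p≤∣p∣ : ∀ p → p ℚ.≤ ℚ.∣ p ∣
  p≤∣p∣ p with ℚP.≤-total 0ℚ p
  ... | inj₁ 0≤p = ℚP.≤-reflexive (sym (ℚP.0≤p⇒∣p∣≡p 0≤p))
  ... | inj₂ p≤0 = ℚP.≤-trans p≤0 (ℚP.0≤∣p∣ p)

  ∣∣<-intro : ∀ {p ε} → p ℚ.< ε → ℚ.- p ℚ.< ε → ℚ.∣ p ∣ ℚ.< ε
  ∣∣<-intro {p} h₁ h₂ with ℚP.∣p∣≡p∨∣p∣≡-p p
  ... | inj₁ e = subst (ℚ._< _) (sym e) h₁
  ... | inj₂ e = subst (ℚ._< _) (sym e) h₂

  swap- : ∀ p q → ℚ.- (p ℚ.- q) ≡ q ℚ.- p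
  swap- = solve 2 (λ p q → :- (p :- q) := q :- p) refl
    where open +-*-Solver

  ∣-∣-sym : ∀ p q → ℚ.∣ p ℚ.- q ∣ ≡ ℚ.∣ q ℚ.- p ∣
  ∣-∣-sym p q = trans (sym (ℚP.∣-p∣≡∣p∣ (p ℚ.- q))) (cong ℚ.∣_∣ (swap- p q))

  half : ∀ {ε} → 0ℚ ℚ.< ε → 0ℚ ℚ.< ℚ.½ ℚ.* ε
  half {ε} 0<ε = subst (ℚ._< ℚ.½ ℚ.* ε) (ℚP.*-zeroʳ ℚ.½) (ℚP.*-monoʳ-<-pos ℚ.½ 0<ε)

  halves : ∀ ε → ℚ.½ ℚ.* ε ℚ.+ ℚ.½ ℚ.* ε ≡ ε
  halves ε = trans (sym (ℚP.*-distribʳ-+ ε ℚ.½ ℚ.½)) (ℚP.*-identityˡ ε)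

  ⊔ˡ : ∀ m n {k} → m ℕ.⊔ n ℕ.≤ k → m ℕ.≤ k
  ⊔ˡ m n = ℕP.≤-trans (ℕP.m≤m⊔n m n)

  ⊔ʳ : ∀ m n {k} → m ℕ.⊔ n ℕ.≤ k → n ℕ.≤ k
  ⊔ʳ m n = ℕP.≤-trans (ℕP.m≤n⊔m m n)

  cauchy-const : ∀ q → Cauchy (λ _ → q)
  cauchy-const q ε 0<ε = 0 , λ _ _ _ _ →
    subst (ℚ._< ε) (sym (cong ℚ.∣_∣ (ℚP.+-inverseʳ q))) 0<ε

  cauchy-+ : ∀ {s t} → Cauchy s → Cauchy t → Cauchy (λ k → s k ℚ.+ t k)
  cauchy-+ {s} {t} cs ct ε 0<ε
    with cs (ℚ.½ ℚ.* ε) (half 0<ε) | ct (ℚ.½ ℚ.* ε) (half 0<ε)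
  ... | N₁ , h₁ | N₂ , h₂ = N₁ ℕ.⊔ N₂ , λ m n p q → begin-strict
      ℚ.∣ (s m ℚ.+ t m) ℚ.- (s n ℚ.+ t n) ∣
        ≡⟨ cong ℚ.∣_∣ (rearr (s m) (t m) (s n) (t n)) ⟩
      ℚ.∣ (s m ℚ.- s n) ℚ.+ (t m ℚ.- t n) ∣
        ≤⟨ ℚP.∣p+q∣≤∣p∣+∣q∣ (s m ℚ.- s n) (t m ℚ.- t n) ⟩
      ℚ.∣ s m ℚ.- s n ∣ ℚ.+ ℚ.∣ t m ℚ.- t n ∣
        <⟨ ℚP.+-mono-< (h₁ m n (⊔ˡ N₁ N₂ p) (⊔ˡ N₁ N₂ q)) (h₂ m n (⊔ʳ N₁ N₂ p) (⊔ʳ N₁ N₂ q)) ⟩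
      ℚ.½ ℚ.* ε ℚ.+ ℚ.½ ℚ.* ε
        ≡⟨ halves ε ⟩
      ε ∎
    where
    open ℚP.≤-Reasoning
    rearr : ∀ a b c d → (a ℚ.+ b) ℚ.- (c ℚ.+ d) ≡ (a ℚ.- c) ℚ.+ (b ℚ.- d)
    rearr = solve 4 (λ a b c d → (a :+ b) :- (c :+ d) := (a :- c) :+ (b :- d)) refl
      where open +-*-Solver

  cauchy-neg : ∀ {s} → Cauchy s → Cauchy (λ k → ℚ.- s k)
  cauchy-neg {s} cs ε 0<ε with cs ε 0<ε
  ... | N , h = N , λ m n p q →
      subst (ℚ._< ε) (trans (∣-∣-sym (s m) (s n)) (cong ℚ.∣_∣ (neg-sub (s m) (s n)))) (h m n p q)
    where
    neg-sub : ∀ a b → b ℚ.- a ≡ ℚ.- a ℚ.- (ℚ.- b)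
    neg-sub = solve 2 (λ a b → b :- a := :- a :- (:- b)) refl
      where open +-*-Solver

  cauchy-∣∣ : ∀ {s} → Cauchy s → Cauchy (λ k → ℚ.∣ s k ∣)
  cauchy-∣∣ {s} cs ε 0<ε with cs ε 0<ε
  ... | N , h = N , λ m n p q → ∣∣<-intro
      (ℚP.≤-<-trans (reverse-triangle (s m) (s n)) (h m n p q))
      (subst (ℚ._< ε) (sym (swap- ℚ.∣ s m ∣ ℚ.∣ s n ∣))
        (ℚP.≤-<-trans (reverse-triangle (s n) (s m)) (h n m q p)))
    where
    reverse-triangle : ∀ a b → ℚ.∣ a ∣ ℚ.- ℚ.∣ b ∣ ℚ.≤ ℚ.∣ a ℚ.- b ∣
    reverse-triangle a b = begin
      ℚ.∣ a ∣ ℚ.- ℚ.∣ b ∣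
        ≡⟨ cong (λ x → ℚ.∣ x ∣ ℚ.- ℚ.∣ b ∣) (split a b) ⟩
      ℚ.∣ (a ℚ.- b) ℚ.+ b ∣ ℚ.- ℚ.∣ b ∣
        ≤⟨ ℚP.+-monoˡ-≤ (ℚ.- ℚ.∣ b ∣) (ℚP.∣p+q∣≤∣p∣+∣q∣ (a ℚ.- b) b) ⟩
      (ℚ.∣ a ℚ.- b ∣ ℚ.+ ℚ.∣ b ∣) ℚ.- ℚ.∣ b ∣
        ≡⟨ cancel ℚ.∣ a ℚ.- b ∣ ℚ.∣ b ∣ ⟩
      ℚ.∣ a ℚ.- b ∣ ∎
      where
      open ℚP.≤-Reasoning
      open +-*-Solver
      split : ∀ a b → a ≡ (a ℚ.- b) ℚ.+ b
      split = solve 2 (λ a b → a := (a :- b) :+ b) refl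
      cancel : ∀ a b → (a ℚ.+ b) ℚ.- b ≡ a
      cancel = solve 2 (λ a b → (a :+ b) :- b := a) refl

  cauchy-⊓ : ∀ {s t} → Cauchy s → Cauchy t → Cauchy (λ k → s k ℚ.⊓ t k)
  cauchy-⊓ {s} {t} cs ct ε 0<ε with cs ε 0<ε | ct ε 0<ε
  ... | N₁ , h₁ | N₂ , h₂ = N₁ ℕ.⊔ N₂ , λ m n p q → ∣∣<-intro
      (one-sided (s m) (t m) (s n) (t n)
        (h₁ m n (⊔ˡ N₁ N₂ p) (⊔ˡ N₁ N₂ q)) (h₂ m n (⊔ʳ N₁ N₂ p) (⊔ʳ N₁ N₂ q)))
      (subst (ℚ._< ε) (sym (swap- (s m ℚ.⊓ t m) (s n ℚ.⊓ t n)))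
        (one-sided (s n) (t n) (s m) (t m)
          (h₁ n m (⊔ˡ N₁ N₂ q) (⊔ˡ N₁ N₂ p)) (h₂ n m (⊔ʳ N₁ N₂ q) (⊔ʳ N₁ N₂ p))))
    where
    one-sided : ∀ a b c d → ℚ.∣ a ℚ.- c ∣ ℚ.< ε → ℚ.∣ b ℚ.- d ∣ ℚ.< ε →
                (a ℚ.⊓ b) ℚ.- (c ℚ.⊓ d) ℚ.< ε
    one-sided a b c d h h′ with ℚP.⊓-sel c d
    ... | inj₁ e rewrite e = ℚP.≤-<-trans (ℚP.+-monoˡ-≤ (ℚ.- c) (ℚP.p⊓q≤p a b))
                               (ℚP.≤-<-trans (p≤∣p∣ (a ℚ.- c)) h)
    ... | inj₂ e rewrite e = ℚP.≤-<-trans (ℚP.+-monoˡ-≤ (ℚ.- d) (ℚP.p⊓q≤q a b))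
                               (ℚP.≤-<-trans (p≤∣p∣ (b ℚ.- d)) h′)

  eventually-bounded : ∀ {s} → Cauchy s →
    ∃ λ K → 0ℚ ℚ.< K × ∃ λ N → ∀ n → N ℕ.≤ n → ℚ.∣ s n ∣ ℚ.< K
  eventually-bounded {s} cs with cs 1ℚ (ℚP.positive⁻¹ 1ℚ)
  ... | N , h = 1ℚ ℚ.+ ℚ.∣ s N ∣ , 0<K , N , λ n N≤n → begin-strict
      ℚ.∣ s n ∣
        ≡⟨ cong ℚ.∣_∣ (split (s n) (s N)) ⟩
      ℚ.∣ (s n ℚ.- s N) ℚ.+ s N ∣
        ≤⟨ ℚP.∣p+q∣≤∣p∣+∣q∣ (s n ℚ.- s N) (s N) ⟩
      ℚ.∣ s n ℚ.- s N ∣ ℚ.+ ℚ.∣ s N ∣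
        <⟨ ℚP.+-monoˡ-< ℚ.∣ s N ∣ (h n N N≤n ℕP.≤-refl) ⟩
      1ℚ ℚ.+ ℚ.∣ s N ∣ ∎
    where
    open ℚP.≤-Reasoning
    split : ∀ a b → a ≡ (a ℚ.- b) ℚ.+ b
    split = solve 2 (λ a b → a := (a :- b) :+ b) refl
      where open +-*-Solver
    0<K : 0ℚ ℚ.< 1ℚ ℚ.+ ℚ.∣ s N ∣
    0<K = ℚP.+-mono-<-≤ (ℚP.positive⁻¹ 1ℚ) (ℚP.0≤∣p∣ (s N))

  quotient : ∀ C ε → 0ℚ ℚ.< C → 0ℚ ℚ.< ε → ∃ λ δ → 0ℚ ℚ.< δ × C ℚ.* δ ≡ ε
  quotient C ε 0<C 0<ε = C⁻¹ ℚ.* ε , 0<δ , Cδ≡ε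
    where
    instance
      C-pos : ℚ.Positive C
      C-pos = ℚ.positive 0<C
      C-nonZero : ℚ.NonZero C
      C-nonZero = ℚP.pos⇒nonZero C
    C⁻¹ : ℚ
    C⁻¹ = ℚ.1/ C
    0<δ : 0ℚ ℚ.< C⁻¹ ℚ.* ε
    0<δ = subst (ℚ._< C⁻¹ ℚ.* ε) (ℚP.*-zeroʳ C⁻¹)
            (ℚP.*-monoʳ-<-pos C⁻¹ {{ℚP.1/pos⇒pos C}} 0<ε)
    Cδ≡ε : C ℚ.* (C⁻¹ ℚ.* ε) ≡ ε
    Cδ≡ε = trans (sym (ℚP.*-assoc C C⁻¹ ε))
             (trans (cong (ℚ._* ε) (ℚP.*-inverseʳ C)) (ℚP.*-identityˡ ε))

  ∣*∣< : ∀ a b {B δ} → 0ℚ ℚ.< B → ℚ.∣ a ∣ ℚ.< B → ℚ.∣ b ∣ ℚ.< δ → ℚ.∣ a ℚ.* b ∣ ℚ.< B ℚ.* δ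
  ∣*∣< a b {B} {δ} 0<B ha hb = begin-strict
    ℚ.∣ a ℚ.* b ∣          ≡⟨ ℚP.∣p*q∣≡∣p∣*∣q∣ a b ⟩
    ℚ.∣ a ∣ ℚ.* ℚ.∣ b ∣    ≤⟨ ℚP.*-monoʳ-≤-nonNeg ℚ.∣ b ∣ {{ℚP.∣-∣-nonNeg b}} (ℚP.<⇒≤ ha) ⟩
    B ℚ.* ℚ.∣ b ∣          <⟨ ℚP.*-monoʳ-<-pos B {{ℚ.positive 0<B}} hb ⟩
    B ℚ.* δ ∎
    where open ℚP.≤-Reasoning

  ∣*-*∣< : ∀ a b c d {K L δ} → 0ℚ ℚ.< K → 0ℚ ℚ.< L → ℚ.∣ a ∣ ℚ.< K → ℚ.∣ d ∣ ℚ.< L →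
           ℚ.∣ a ℚ.- c ∣ ℚ.< δ → ℚ.∣ b ℚ.- d ∣ ℚ.< δ →
           ℚ.∣ a ℚ.* b ℚ.- c ℚ.* d ∣ ℚ.< (K ℚ.+ L) ℚ.* δ
  ∣*-*∣< a b c d {K} {L} {δ} 0<K 0<L ha hd hac hbd = begin-strict
    ℚ.∣ a ℚ.* b ℚ.- c ℚ.* d ∣
      ≡⟨ cong ℚ.∣_∣ (rearr a b c d) ⟩
    ℚ.∣ a ℚ.* (b ℚ.- d) ℚ.+ d ℚ.* (a ℚ.- c) ∣
      ≤⟨ ℚP.∣p+q∣≤∣p∣+∣q∣ (a ℚ.* (b ℚ.- d)) (d ℚ.* (a ℚ.- c)) ⟩
    ℚ.∣ a ℚ.* (b ℚ.- d) ∣ ℚ.+ ℚ.∣ d ℚ.* (a ℚ.- c) ∣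
      <⟨ ℚP.+-mono-< (∣*∣< a (b ℚ.- d) 0<K ha hbd) (∣*∣< d (a ℚ.- c) 0<L hd hac) ⟩
    K ℚ.* δ ℚ.+ L ℚ.* δ
      ≡⟨ ℚP.*-distribʳ-+ δ K L ⟨
    (K ℚ.+ L) ℚ.* δ ∎
    where
    open ℚP.≤-Reasoning
    rearr : ∀ a b c d → a ℚ.* b ℚ.- c ℚ.* d ≡ a ℚ.* (b ℚ.- d) ℚ.+ d ℚ.* (a ℚ.- c)
    rearr = solve 4 (λ a b c d → a :* b :- c :* d := a :* (b :- d) :+ d :* (a :- c)) refl
      where open +-*-Solver

  cauchy-* : ∀ {s t} → Cauchy s → Cauchy t → Cauchy (λ k → s k ℚ.* t k)
  cauchy-* {s} {t} cs ct ε 0<ε =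
    let K , 0<K , N₁ , bs = eventually-bounded cs
        L , 0<L , N₂ , bt = eventually-bounded ct
        δ , 0<δ , [K+L]δ≡ε = quotient (K ℚ.+ L) ε (ℚP.+-mono-< 0<K 0<L) 0<ε
        N₃ , hs = cs δ 0<δ
        N₄ , ht = ct δ 0<δ
    in (N₁ ℕ.⊔ N₂) ℕ.⊔ (N₃ ℕ.⊔ N₄) , λ m n p q →
      subst (ℚ.∣ s m ℚ.* t m ℚ.- s n ℚ.* t n ∣ ℚ.<_) [K+L]δ≡ε
        (∣*-*∣< (s m) (t m) (s n) (t n) 0<K 0<L
          (bs m (⊔ˡ N₁ N₂ (⊔ˡ (N₁ ℕ.⊔ N₂) (N₃ ℕ.⊔ N₄) p)))
          (bt n (⊔ʳ N₁ N₂ (⊔ˡ (N₁ ℕ.⊔ N₂) (N₃ ℕ.⊔ N₄) q)))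
          (hs m n (⊔ˡ N₃ N₄ (⊔ʳ (N₁ ℕ.⊔ N₂) (N₃ ℕ.⊔ N₄) p)) (⊔ˡ N₃ N₄ (⊔ʳ (N₁ ℕ.⊔ N₂) (N₃ ℕ.⊔ N₄) q)))
          (ht m n (⊔ʳ N₃ N₄ (⊔ʳ (N₁ ℕ.⊔ N₂) (N₃ ℕ.⊔ N₄) p)) (⊔ʳ N₃ N₄ (⊔ʳ (N₁ ℕ.⊔ N₂) (N₃ ℕ.⊔ N₄) q))))

open CauchyClosure

infixl 6 _+_ _-_
infixl 7 _*_ _⊓_
infix  8 -_
infix  4 _≈_ _≤_ _<_

fromℚ : ℚ → ℝ
fromℚ q .seq    = λ _ → q
fromℚ q .cauchy = cauchy-const q

fromℕ : ℕ → ℝ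
fromℕ n = fromℚ (+ n ℚ./ 1)

0ℝ 1ℝ : ℝ
0ℝ = fromℚ 0ℚ
1ℝ = fromℚ 1ℚ

_+_ : ℝ → ℝ → ℝ
(x + y) .seq    = λ k → seq x k ℚ.+ seq y k
(x + y) .cauchy = cauchy-+ {seq x} {seq y} (cauchy x) (cauchy y)

_*_ : ℝ → ℝ → ℝ
(x * y) .seq    = λ k → seq x k ℚ.* seq y k
(x * y) .cauchy = cauchy-* {seq x} {seq y} (cauchy x) (cauchy y)

_⊓_ : ℝ → ℝ → ℝ
(x ⊓ y) .seq    = λ k → seq x k ℚ.⊓ seq y k
(x ⊓ y) .cauchy = cauchy-⊓ {seq x} {seq y} (cauchy x) (cauchy y)

-_ : ℝ → ℝ
(- x) .seq    = λ k → ℚ.- seq x k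
(- x) .cauchy = cauchy-neg {seq x} (cauchy x)

∣_∣ : ℝ → ℝ
∣ x ∣ .seq    = λ k → ℚ.∣ seq x k ∣
∣ x ∣ .cauchy = cauchy-∣∣ {seq x} (cauchy x)

_-_ : ℝ → ℝ → ℝ
x - y = x + (- y)

_≈_ _≤_ _<_ : Rel ℝ 0ℓ
x ≈ y = ∀ ε → 0ℚ ℚ.< ε → ∃ λ N → ∀ n → N ℕ.≤ n → ℚ.∣ seq x n ℚ.- seq y n ∣ ℚ.< ε
x ≤ y = ∀ ε → 0ℚ ℚ.< ε → ∃ λ N → ∀ n → N ℕ.≤ n → seq x n ℚ.< seq y n ℚ.+ ε
x < y = ∃ λ δ → 0ℚ ℚ.< δ × ∃ λ N → ∀ n → N ℕ.≤ n → seq x n ℚ.+ δ ℚ.< seq y n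

Matrix : ℕ → Set
Matrix n = Vector (Vector ℝ n) n

infix 4 _≋_

_≋_ : ∀ {n} → Rel (Vector ℝ n) 0ℓ
v ≋ w = ∀ k → v k ≈ w k

sum : ∀ {n} → Vector ℝ n → ℝ
sum = Vector.foldr _+_ 0ℝ

dot : ∀ {n} → Vector ℝ n → Vector ℝ n → ℝ
dot v w = sum λ k → v k * w k

_·_ : ∀ {n} → Matrix n → Vector ℝ n → Vector ℝ n
(A · v) i = dot (A i) v

quadraticForm : ∀ {n} → Matrix n → Vector ℝ n → ℝ
quadraticForm A v = dot v (A · v)

-- Iverson bracket
[_] : ∀ {p} {P : Set p} → Dec P → ℝ
[ d ] = if does d then 1ℝ else 0ℝ

𝟏 : ∀ {n} → Vector ℝ n
𝟏 _ = 1ℝ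

basis : ∀ {n} → Fin n → Vector ℝ n
basis i k = [ i Fin.≟ k ]

identity : ∀ {n} → Matrix n
identity = basis

-- Convergence in ℝⁿ, in the sup norm
_⟶_ : ∀ {n} → (ℕ → Vector ℝ n) → Vector ℝ n → Set
w ⟶ v = ∀ ε → 0ℝ < ε → ∃ λ N → ∀ n → N ℕ.≤ n → ∀ k → ∣ w n k - v k ∣ < ε

record Graph : Set₁ where
  field
    order  : ℕ
    _~_    : Rel (Fin order) 0ℓ
    _~?_   : Decidable _~_
    symm   : Symmetric _~_
    irrefl : Irreflexive _≡_ _~_

adjacencyMatrix : (G : Graph) → Matrix (Graph.order G)
adjacencyMatrix G u v = [ u ~? v ]
  where open Graph G

module _ (G : Graph) where
  open Graph G

  -- Each edge {u , v} is listed exactly once, as the pair with u < v.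
  edges : List (Fin order × Fin order)
  edges = List.filter (λ (u , v) → (u Fin.<? v) ×-dec (u ~? v))
            (List.cartesianProduct (List.allFin order) (List.allFin order))

  size : ℕ
  size = List.length edges

  E : Set
  E = Fin size

  _∈ₑ_ : Fin order → E → Set
  x ∈ₑ e = x ≡ proj₁ (List.lookup edges e) ⊎ x ≡ proj₂ (List.lookup edges e)

  _∈ₑ?_ : Decidable _∈ₑ_
  x ∈ₑ? e = (x Fin.≟ proj₁ (List.lookup edges e)) ⊎-dec (x Fin.≟ proj₂ (List.lookup edges e))

  lineGraph : Graph
  lineGraph = record
    { order  = size
    ; _~_    = λ e e′ → e ≢ e′ × ∃ λ x → x ∈ₑ e × x ∈ₑ e′
    ; _~?_   = λ e e′ → ¬? (e Fin.≟ e′) ×-dec FinP.any? λ x → (x ∈ₑ? e) ×-dec (x ∈ₑ? e′)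
    ; symm   = λ (e≢e′ , x , p , q) → (λ e′≡e → e≢e′ (sym e′≡e)) , x , q , p
    ; irrefl = λ e≡e′ (e≢e′ , _) → e≢e′ e≡e′
    }

  M₂ : Matrix size
  M₂ e e′ = fromℕ 4 * identity e e′ + adjacencyMatrix lineGraph e e′

  f : Vector ℝ size → ℝ
  f = quadraticForm M₂

  R : Vector ℝ size → Set
  R w = dot 𝟏 w ≈ fromℕ size × (∀ e → 0ℝ ≤ w e)

  IsMinimizer : Vector ℝ size → Set
  IsMinimizer w = R w × (∀ v → R v → f w ≤ f v)

  t : Vector ℝ size → E → E → ℝ
  t w i j = ((M₂ · w) j - (M₂ · w) i) * fromℚ (+ 1 ℚ./ 8)

  η : Vector ℝ size → E → E → ℝ
  η w i j = t w i j ⊓ w j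

  -- Any choice of i and of j among ties is allowed.
  Step : Rel (Vector ℝ size) 0ℓ
  Step w w′ = ∃ λ i → (∀ k → (M₂ · w) i ≤ (M₂ · w) k) ×
              ∃ λ j → (∀ k → η w i k ≤ η w i j) ×
              w′ ≋ (λ k → w k + η w i j * (basis i k - basis j k))

  IsRun : (ℕ → Vector ℝ size) → Set
  IsRun w = w 0 ≋ 𝟏 × (∀ n → Step (w n) (w (suc n)))

{-# OPTIONS --safe #-}
module Submission where

-- With N the vertex-edge incidence matrix, M₂ = 2I + NᵀN, so f is strongly convex:
-- 2|v - w|² ≤ f v - f w - 2 (M₂ w)·(v - w).  If w is feasible and a step moves the weight
-- s = η_j, then f decreases by at least s², because s ≤ t_j and the entries of M₂ are
-- nonnegative.  On the other hand (M₂ w)·(w - v) ≤ 8 Σ t_k w_k for every feasible v, and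
-- t_k w_k = min(t_k, w_k) max(t_k, w_k) ≤ s (t_k + w_k), so this gap is O(s).  Hence
-- |v - w|² ≤ f v - f w + C s.  Since Σ sₙ² ≤ f w₀, some step is as small as we like; at such
-- a step n all feasible v with f v ≤ f wₙ lie close to wₙ.  Applied to the later iterates
-- this gives a Cauchy sequence, and applied to minimizers it gives uniqueness.

open import Level using (0ℓ)
open import Algebra.Bundles using (CommutativeRing)
open import Data.Nat as ℕ using (ℕ; zero; suc)
import Data.Nat.Properties as ℕP
open import Data.Nat.Coprimality as Coprime using (1-coprimeTo)
open import Data.Integer as ℤ using (+_)
import Data.Integer.Properties as ℤP
open import Data.Rational as ℚ using (ℚ; 0ℚ; 1ℚ)
import Data.Rational.Properties as ℚP
open import Data.Rational.Solver using (module +-*-Solver)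
open import Data.Fin as Fin using (Fin)
import Data.Fin.Properties as FinP
open import Data.List as List using (List)
import Data.List.Relation.Unary.All as All
import Data.List.Relation.Unary.All.Properties as AllP
open import Data.List.Relation.Unary.AllPairs using (_∷_)
open import Data.List.Relation.Unary.Unique.Propositional using (Unique)
import Data.List.Relation.Unary.Unique.Propositional.Properties as Unique
open import Data.List.Membership.Propositional.Properties using (∈-lookup)
open import Data.Product using (∃; _×_; _,_; proj₁; proj₂)
open import Data.Product.Properties using (×-≡,≡→≡)
open import Data.Sum using (_⊎_; inj₁; inj₂; map₂)
open import Data.Vec.Functional using (Vector)
open import Function using (_∘_; flip)
open import Relation.Nullary using (Dec; yes; no; ¬_; contradiction)
open import Relation.Nullary.Decidable using (_×-dec_)
open import Relation.Binary.Bundles using (Poset)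
open import Relation.Binary.PropositionalEquality as ≡ using (_≡_; _≢_; cong; subst)
open import Defs
open CauchyClosure

-- The ordered ring of reals

-- Classically, compactness of `R` supplies a minimizer and convergent subsequences. With reals
-- given as Cauchy sequences and an undecidable order neither is at hand, so the minimizer has to be
-- built as the limit of the run itself. This is why the estimate compares an iterate with every
-- feasible `v` and not with a given minimizer. Because `f` decreases along the run, one small step
-- controls all later iterates, and only the existence of a small step has to be extracted from the
-- descent. The constant 8 comes from line search: for `g = M₂ w`, moving `s` from `j` to `i`
-- changes `f` by `-2s(g_j - g_i) + s²(8 - 2 M₂ i j)` when `i` and `j` differ, and for nonadjacent
-- edges this is least at `s = t_j`. The cap `w_j` keeps the iterate nonnegative; it is also why the
-- gap has to be bounded through products `t_k w_k` rather than through `t_k` alone.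

Null : (ℕ → ℚ) → Set
Null s = ∀ ε → 0ℚ ℚ.< ε → ∃ λ N → ∀ n → N ℕ.≤ n → ℚ.∣ s n ∣ ℚ.< ε

null-resp : ∀ {s t : ℕ → ℚ} → (∀ k → s k ≡ t k) → Null s → Null t
null-resp s≡t null ε 0<ε with null ε 0<ε
... | N , h = N , λ n N≤n → subst (λ q → ℚ.∣ q ∣ ℚ.< ε) (s≡t n) (h n N≤n)

null-0 : ∀ {s : ℕ → ℚ} → (∀ k → s k ≡ 0ℚ) → Null s
null-0 s≡0 = null-resp (λ k → ≡.sym (s≡0 k)) λ ε 0<ε → 0 , λ _ _ → 0<ε

null-neg : ∀ {s : ℕ → ℚ} → Null s → Null (λ k → ℚ.- s k)
null-neg {s} null ε 0<ε with null ε 0<ε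
... | N , h = N , λ n N≤n → subst (ℚ._< ε) (≡.sym (ℚP.∣-p∣≡∣p∣ (s n))) (h n N≤n)

null-+ : ∀ {s t : ℕ → ℚ} → Null s → Null t → Null (λ k → s k ℚ.+ t k)
null-+ {s} {t} ns nt ε 0<ε with ns (ℚ.½ ℚ.* ε) (half 0<ε) | nt (ℚ.½ ℚ.* ε) (half 0<ε)
... | N₁ , h₁ | N₂ , h₂ = N₁ ℕ.⊔ N₂ , λ n p →
  ℚP.≤-<-trans (ℚP.∣p+q∣≤∣p∣+∣q∣ (s n) (t n))
    (subst (_ ℚ.<_) (halves ε) (ℚP.+-mono-< (h₁ n (⊔ˡ N₁ N₂ p)) (h₂ n (⊔ʳ N₁ N₂ p))))

null-* : ∀ {s t : ℕ → ℚ} → Cauchy s → Null t → Null (λ k → s k ℚ.* t k)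
null-* {s} {t} cs nt ε 0<ε =
  let K , 0<K , N₁ , bs = eventually-bounded cs
      δ , 0<δ , Kδ≡ε = quotient K ε 0<K 0<ε
      N₂ , ht = nt δ 0<δ
  in N₁ ℕ.⊔ N₂ , λ n p → subst (ℚ.∣ s n ℚ.* t n ∣ ℚ.<_) Kδ≡ε
       (∣*∣< (s n) (t n) 0<K (bs n (⊔ˡ N₁ N₂ p)) (ht n (⊔ʳ N₁ N₂ p)))

infix 4 _≃_ _≼_

-- _≈_ and _≤_ unfold to statements about the sequences, from which Agda cannot
-- recover the reals; these wrappers keep the two sides inferable.
record _≃_ (x y : ℝ) : Set where
  constructor mk≃
  field get≃ : x ≈ y
open _≃_ public

record _≼_ (x y : ℝ) : Set where
  constructor mk≼
  field get≼ : x ≤ y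
open _≼_ public

pw≃ : ∀ {x y} → (∀ k → seq x k ≡ seq y k) → x ≃ y
pw≃ {x} {y} h = mk≃ (null-0 λ k →
  ≡.trans (cong (ℚ._- seq y k) (h k)) (ℚP.+-inverseʳ (seq y k)))

≃-refl : ∀ {x} → x ≃ x
≃-refl = pw≃ λ _ → ≡.refl

≃-sym : ∀ {x y} → x ≃ y → y ≃ x
≃-sym {x} {y} (mk≃ h) = mk≃ (null-resp (λ k → swap- (seq x k) (seq y k)) (null-neg h))

≃-trans : ∀ {x y z} → x ≃ y → y ≃ z → x ≃ z
≃-trans {x} {y} {z} (mk≃ h) (mk≃ h′) = mk≃ (null-resp
  (λ k → solve 3 (λ a b c → (a :- b) :+ (b :- c) := a :- c) ≡.refl (seq x k) (seq y k) (seq z k))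
  (null-+ h h′))
  where open +-*-Solver

+-cong : ∀ {x x′ y y′} → x ≃ x′ → y ≃ y′ → x + y ≃ x′ + y′
+-cong {x} {x′} {y} {y′} (mk≃ h) (mk≃ h′) = mk≃ (null-resp
  (λ k → solve 4 (λ a b c d → (a :- b) :+ (c :- d) := (a :+ c) :- (b :+ d)) ≡.refl
    (seq x k) (seq x′ k) (seq y k) (seq y′ k))
  (null-+ h h′))
  where open +-*-Solver

neg-cong : ∀ {x y} → x ≃ y → - x ≃ - y
neg-cong {x} {y} (mk≃ h) = mk≃ (null-resp
  (λ k → solve 2 (λ a b → :- (a :- b) := (:- a) :- (:- b)) ≡.refl (seq x k) (seq y k))
  (null-neg h))
  where open +-*-Solver

*-cong : ∀ {x x′ y y′} → x ≃ x′ → y ≃ y′ → x * y ≃ x′ * y′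
*-cong {x} {x′} {y} {y′} (mk≃ h) (mk≃ h′) = mk≃ (null-resp
  (λ k → solve 4 (λ a b c d → a :* (c :- d) :+ d :* (a :- b) := a :* c :- b :* d) ≡.refl
    (seq x k) (seq x′ k) (seq y k) (seq y′ k))
  (null-+ {λ k → seq x k ℚ.* (seq y k ℚ.- seq y′ k)} {λ k → seq y′ k ℚ.* (seq x k ℚ.- seq x′ k)}
    (null-* {seq x} (cauchy x) h′) (null-* {seq y′} (cauchy y′) h)))
  where open +-*-Solver

ℝ-commutativeRing : CommutativeRing 0ℓ 0ℓ
ℝ-commutativeRing = record
  { Carrier = ℝ ; _≈_ = _≃_ ; _+_ = _+_ ; _*_ = _*_ ; -_ = -_ ; 0# = 0ℝ ; 1# = 1ℝ
  ; isCommutativeRing = record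
    { isRing = record
      { +-isAbelianGroup = record
        { isGroup = record
          { isMonoid = record
            { isSemigroup = record
              { isMagma = record
                { isEquivalence = record { refl = ≃-refl ; sym = ≃-sym ; trans = ≃-trans }
                ; ∙-cong = +-cong }
              ; assoc = λ x y z → pw≃ λ k → ℚP.+-assoc (seq x k) (seq y k) (seq z k) }
            ; identity = (λ x → pw≃ λ k → ℚP.+-identityˡ (seq x k))
                       , (λ x → pw≃ λ k → ℚP.+-identityʳ (seq x k)) }
          ; inverse = (λ x → pw≃ λ k → ℚP.+-inverseˡ (seq x k))
                    , (λ x → pw≃ λ k → ℚP.+-inverseʳ (seq x k))
          ; ⁻¹-cong = neg-cong }
        ; comm = λ x y → pw≃ λ k → ℚP.+-comm (seq x k) (seq y k) }
      ; *-cong = *-cong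
      ; *-assoc = λ x y z → pw≃ λ k → ℚP.*-assoc (seq x k) (seq y k) (seq z k)
      ; *-identity = (λ x → pw≃ λ k → ℚP.*-identityˡ (seq x k))
                   , (λ x → pw≃ λ k → ℚP.*-identityʳ (seq x k))
      ; distrib = (λ x y z → pw≃ λ k → ℚP.*-distribˡ-+ (seq x k) (seq y k) (seq z k))
                , (λ x y z → pw≃ λ k → ℚP.*-distribʳ-+ (seq x k) (seq y k) (seq z k)) }
    ; *-comm = λ x y → pw≃ λ k → ℚP.*-comm (seq x k) (seq y k) }
  }

open CommutativeRing ℝ-commutativeRing
  using (semiring; *-comm; *-identityˡ; *-identityʳ; zeroʳ; +-identityʳ; +-identityˡ)
  renaming (reflexive to ≃-reflexive)
open import Algebra.Properties.Semiring.Sum semiring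
  using (sum-cong-≋; ∑-distrib-+; ∑-comm; *-distribˡ-sum; *-distribʳ-sum; sum-replicate-zero)

ev≼ : ∀ {x y} → (∃ λ N → ∀ n → N ℕ.≤ n → seq x n ℚ.≤ seq y n) → x ≼ y
ev≼ {x} {y} (N , h) = mk≼ λ ε 0<ε → N , λ n N≤n → ℚP.≤-<-trans (h n N≤n)
  (subst (ℚ._< seq y n ℚ.+ ε) (ℚP.+-identityʳ (seq y n)) (ℚP.+-monoʳ-< (seq y n) 0<ε))

pw≼ : ∀ {x y} → (∀ k → seq x k ℚ.≤ seq y k) → x ≼ y
pw≼ h = ev≼ (0 , λ n _ → h n)

≃⇒≼ : ∀ {x y} → x ≃ y → x ≼ y
≃⇒≼ {x} {y} (mk≃ h) = mk≼ λ ε 0<ε → let N , h′ = h ε 0<ε in N , λ n N≤n →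
  subst (ℚ._< seq y n ℚ.+ ε)
    (solve 2 (λ a b → b :+ (a :- b) := a) ≡.refl (seq x n) (seq y n))
    (ℚP.+-monoʳ-< (seq y n) (ℚP.≤-<-trans (p≤∣p∣ _) (h′ n N≤n)))
  where open +-*-Solver

+-mono-≼ : ∀ {x x′ y y′} → x ≼ x′ → y ≼ y′ → x + y ≼ x′ + y′
+-mono-≼ {x} {x′} {y} {y′} (mk≼ h) (mk≼ h′) = mk≼ λ ε 0<ε →
  let N₁ , h₁ = h (ℚ.½ ℚ.* ε) (half 0<ε)
      N₂ , h₂ = h′ (ℚ.½ ℚ.* ε) (half 0<ε)
  in N₁ ℕ.⊔ N₂ , λ n p → subst (seq x n ℚ.+ seq y n ℚ.<_)
       (≡.trans (solve 3 (λ a b e → (a :+ e) :+ (b :+ e) := (a :+ b) :+ (e :+ e)) ≡.refl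
                  (seq x′ n) (seq y′ n) (ℚ.½ ℚ.* ε))
                (cong (seq x′ n ℚ.+ seq y′ n ℚ.+_) (halves ε)))
       (ℚP.+-mono-< (h₁ n (⊔ˡ N₁ N₂ p)) (h₂ n (⊔ʳ N₁ N₂ p)))
  where open +-*-Solver

≼-trans : ∀ {x y z} → x ≼ y → y ≼ z → x ≼ z
≼-trans {x} {y} {z} (mk≼ h) (mk≼ h′) = mk≼ λ ε 0<ε →
  let N₁ , h₁ = h (ℚ.½ ℚ.* ε) (half 0<ε)
      N₂ , h₂ = h′ (ℚ.½ ℚ.* ε) (half 0<ε)
  in N₁ ℕ.⊔ N₂ , λ n p → ℚP.<-trans (h₁ n (⊔ˡ N₁ N₂ p)) (subst (_ ℚ.<_)
       (≡.trans (ℚP.+-assoc (seq z n) _ _) (cong (seq z n ℚ.+_) (halves ε)))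
       (ℚP.+-monoˡ-< (ℚ.½ ℚ.* ε) (h₂ n (⊔ʳ N₁ N₂ p))))

≼-antisym : ∀ {x y} → x ≼ y → y ≼ x → x ≃ y
≼-antisym {x} {y} (mk≼ h) (mk≼ h′) = mk≃ λ ε 0<ε →
  let N₁ , h₁ = h ε 0<ε
      N₂ , h₂ = h′ ε 0<ε
  in N₁ ℕ.⊔ N₂ , λ n p → ∣∣<-intro
       (shift (seq x n) (seq y n) (h₁ n (⊔ˡ N₁ N₂ p)))
       (subst (ℚ._< ε) (≡.sym (swap- (seq x n) (seq y n))) (shift (seq y n) (seq x n) (h₂ n (⊔ʳ N₁ N₂ p))))
  where
  open +-*-Solver
  shift : ∀ a b {e} → a ℚ.< b ℚ.+ e → a ℚ.- b ℚ.< e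
  shift a b {e} a<b+e = subst (a ℚ.- b ℚ.<_)
    (solve 2 (λ b e → b :+ e :- b := e) ≡.refl b e) (ℚP.+-monoˡ-< (ℚ.- b) a<b+e)

≼-poset : Poset 0ℓ 0ℓ 0ℓ
≼-poset = record
  { _≈_ = _≃_ ; _≤_ = _≼_
  ; isPartialOrder = record
    { isPreorder = record
      { isEquivalence = record { refl = ≃-refl ; sym = ≃-sym ; trans = ≃-trans }
      ; reflexive = ≃⇒≼ ; trans = ≼-trans }
    ; antisym = ≼-antisym } }

≼-refl : ∀ {x} → x ≼ x
≼-refl = ≃⇒≼ ≃-refl

≼-resp : ∀ {x x′ y y′} → x ≃ x′ → y ≃ y′ → x ≼ y → x′ ≼ y′
≼-resp p q h = ≼-trans (≃⇒≼ (≃-sym p)) (≼-trans h (≃⇒≼ q))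

-- A certificate d of nonnegativity together with a ring identity proves an inequality.
≼-from : ∀ {x y d} → 0ℝ ≼ d → (∀ k → seq x k ℚ.+ seq d k ≡ seq y k) → x ≼ y
≼-from {x} {y} {d} 0≼d h = ≼-trans
  (pw≼ λ k → ℚP.≤-reflexive (≡.sym (ℚP.+-identityʳ (seq x k))))
  (≼-trans (+-mono-≼ (≼-refl {x}) 0≼d) (≃⇒≼ (pw≃ h)))

0≼fromℕ : ∀ n → 0ℝ ≼ fromℕ n
0≼fromℕ n = pw≼ λ _ → ℚP.nonNegative⁻¹ _ {{ℚP.normalize-nonNeg n 1}}

≼⇒0≼ : ∀ {x y} → x ≼ y → 0ℝ ≼ y - x
≼⇒0≼ {x} {y} h = ≼-trans (≃⇒≼ (pw≃ λ k → ≡.sym (ℚP.+-inverseʳ (seq x k)))) (+-mono-≼ h (≼-refl { - x}))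

0≼+ : ∀ {x y} → 0ℝ ≼ x → 0ℝ ≼ y → 0ℝ ≼ x + y
0≼+ p q = ≼-trans (pw≼ λ _ → ℚP.≤-refl) (+-mono-≼ p q)

-- A nonnegative real may have negative rational terms. Passing to `∣ x ∣` gives a representative
-- with nonnegative terms, for which `0≼*` becomes a termwise statement.
0≼⇒≃∣∣ : ∀ {x} → 0ℝ ≼ x → x ≃ ∣ x ∣
0≼⇒≃∣∣ {x} (mk≼ h) = mk≃ λ ε 0<ε → let N , h′ = h (ℚ.½ ℚ.* ε) (half 0<ε) in
  N , λ n N≤n → bound (seq x n) ε 0<ε (h′ n N≤n)
  where
  open +-*-Solver
  bound : ∀ a ε → 0ℚ ℚ.< ε → 0ℚ ℚ.< a ℚ.+ ℚ.½ ℚ.* ε → ℚ.∣ a ℚ.- ℚ.∣ a ∣ ∣ ℚ.< ε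
  bound a ε 0<ε h with ℚP.∣p∣≡p∨∣p∣≡-p a
  ... | inj₁ e rewrite e | ℚP.+-inverseʳ a = 0<ε
  -- Here `a - ∣a∣ = 2a`, and doubling `0 < a + ε/2` bounds `-2a` by `ε`.
  ... | inj₂ e = ∣∣<-intro
    (ℚP.≤-<-trans (subst (a ℚ.- ℚ.∣ a ∣ ℚ.≤_) (ℚP.+-inverseʳ ℚ.∣ a ∣) (ℚP.+-monoˡ-≤ (ℚ.- ℚ.∣ a ∣) (p≤∣p∣ a))) 0<ε)
    (≡.subst₂ ℚ._<_ (≡.trans (solve 1 (λ a → con 0ℚ :- (a :+ a) := :- (a :+ (:- (:- a)))) ≡.refl a)
               (cong (λ b → ℚ.- (a ℚ.- b)) (≡.sym e)))
             (≡.trans (solve 2 (λ a h → (a :+ h) :+ (a :+ h) :- (a :+ a) := h :+ h)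
                 ≡.refl a (ℚ.½ ℚ.* ε)) (halves ε))
             (ℚP.+-monoˡ-< (ℚ.- (a ℚ.+ a)) (ℚP.+-mono-< h h)))

0≼* : ∀ {x y} → 0ℝ ≼ x → 0ℝ ≼ y → 0ℝ ≼ x * y
0≼* {x} {y} p q = ≼-trans
  (pw≼ λ k → ℚP.nonNegative⁻¹ _
      {{ℚP.nonNeg*nonNeg⇒nonNeg ℚ.∣ seq x k ∣ {{ℚP.∣-∣-nonNeg (seq x k)}} ℚ.∣ seq y k ∣ {{ℚP.∣-∣-nonNeg (seq y k)}}}})
  (≃⇒≼ (≃-sym (*-cong (0≼⇒≃∣∣ p) (0≼⇒≃∣∣ q))))

0≼sq : ∀ x → 0ℝ ≼ x * x
0≼sq x = pw≼ λ k → nonneg (seq x k)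
  where
  nonneg : ∀ a → 0ℚ ℚ.≤ a ℚ.* a
  nonneg a with ℚP.≤-total 0ℚ a
  ... | inj₁ 0≤a = ℚP.nonNegative⁻¹ _
      {{ℚP.nonNeg*nonNeg⇒nonNeg a {{ℚ.nonNegative 0≤a}} a {{ℚ.nonNegative 0≤a}}}}
  ... | inj₂ a≤0 = ℚP.nonNegative⁻¹ _ {{ℚP.nonPos*nonPos⇒nonPos a {{ℚ.nonPositive a≤0}} a {{ℚ.nonPositive a≤0}}}}

*-monoˡ-≼ : ∀ {c x y} → 0ℝ ≼ c → x ≼ y → c * x ≼ c * y
*-monoˡ-≼ {c} {x} {y} 0≼c h = ≼-from (0≼* 0≼c (≼⇒0≼ h))
  (λ k → solve 3 (λ c x y → c :* x :+ c :* (y :- x) := c :* y) ≡.refl (seq c k) (seq x k) (seq y k))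
  where open +-*-Solver

fromℚ-≼ : ∀ {p q} → p ℚ.≤ q → fromℚ p ≼ fromℚ q
fromℚ-≼ h = pw≼ λ _ → h

-- If `p - q` were positive, the hypothesis at `ε = p - q` would read `p < p`. This returns
-- estimates between constants to the decidable order of the rationals.
fromℚ-cancel-≼ : ∀ {p q} → fromℚ p ≼ fromℚ q → p ℚ.≤ q
fromℚ-cancel-≼ {p} {q} (mk≼ h) with p ℚ.≤? q
... | yes p≤q = p≤q
... | no p≰q = contradiction (proj₂ (h (p ℚ.- q) 0<p-q) _ ℕP.≤-refl) λ p<p →
    ℚP.<-irrefl ≡.refl (subst (p ℚ.<_) (solve 2 (λ p q → q :+ (p :- q) := p) ≡.refl p q) p<p)
  where
  open +-*-Solver
  0<p-q : 0ℚ ℚ.< p ℚ.- q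
  0<p-q = subst (ℚ._< p ℚ.- q) (ℚP.+-inverseʳ q) (ℚP.+-monoˡ-< (ℚ.- q) (ℚP.≰⇒> p≰q))

-- The Archimedean property

natℚ : ℕ → ℚ
natℚ n = + n ℚ./ 1

-- The fraction `+ n / 1` is normalised through a gcd that is stuck on a variable `n`; the explicit
-- normal form exposes numerator and denominator.
natℚ≡ : ∀ n → natℚ n ≡ ℚ.mkℚ (+ n) 0 (Coprime.sym (1-coprimeTo n))
natℚ≡ n = ℚP.normalize-coprime (Coprime.sym (1-coprimeTo n))

natℚ-suc : ∀ n → natℚ (suc n) ≡ 1ℚ ℚ.+ natℚ n
natℚ-suc n = ≡.trans
  (cong (λ i → (+ 1 ℤ.+ i) ℚ./ 1) (≡.sym (ℤP.*-identityʳ (+ n))))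
  (cong (1ℚ ℚ.+_) (≡.sym (natℚ≡ n)))

natℚ-mono : ∀ {k n} → k ℕ.≤ n → natℚ k ℚ.≤ natℚ n
natℚ-mono {k} {n} k≤n = ≡.subst₂ ℚ._≤_ (≡.sym (natℚ≡ k)) (≡.sym (natℚ≡ n))
  (ℚ.*≤* (ℤP.*-monoʳ-≤-nonNeg (+ 1) (ℤ.+≤+ k≤n)))

0<natℚ-suc : ∀ n → 0ℚ ℚ.< natℚ (suc n)
0<natℚ-suc n = ℚP.positive⁻¹ _ {{ℚP.normalize-pos (suc n) 1}}

-- The denominator is at least 1, so a nonnegative fraction is at most its numerator; a negative one
-- lies below every natural number.
≤natℚ : ∀ p → p ℚ.≤ natℚ (ℤ.∣ ℚ.numerator p ∣)
≤natℚ p = subst (p ℚ.≤_) (≡.sym (natℚ≡ _)) (go p)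
  where
  go : ∀ p → p ℚ.≤ ℚ.mkℚ (+ ℤ.∣ ℚ.numerator p ∣) 0 (Coprime.sym (1-coprimeTo _))
  go (ℚ.mkℚ (+ n) d-1 _) = ℚ.*≤* (≡.subst₂ ℤ._≤_ (ℤP.pos-* n 1) (ℤP.pos-* n (suc d-1))
    (ℤ.+≤+ (ℕP.*-monoʳ-≤ n (ℕ.s≤s ℕ.z≤n))))
  go (ℚ.mkℚ ℤ.-[1+ n ] d-1 _) = ℚ.*≤* (≡.subst₂ ℤ._≤_ ≡.refl (ℤP.pos-* (suc n) (suc d-1)) ℤ.-≤+)

0<* : ∀ {p q} → 0ℚ ℚ.< p → 0ℚ ℚ.< q → 0ℚ ℚ.< p ℚ.* q
0<* {p} {q} 0<p 0<q = ℚP.positive⁻¹ _ {{ℚP.pos*pos⇒pos p {{ℚ.positive 0<p}} q {{ℚ.positive 0<q}}}}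

archimedes : ∀ K c → 0ℚ ℚ.< K → 0ℚ ℚ.< c → ∃ λ N → K ℚ.≤ c ℚ.* natℚ N
archimedes K c 0<K 0<c =
  let r , _ , cr≡K = quotient c K 0<c 0<K
  in ℤ.∣ ℚ.numerator r ∣ , subst (ℚ._≤ c ℚ.* natℚ ℤ.∣ ℚ.numerator r ∣) cr≡K
       (ℚP.*-monoˡ-≤-nonNeg c {{ℚP.pos⇒nonNeg c {{ℚ.positive 0<c}}}} (≤natℚ r))

-- The order on ℝ is undecidable; overlapping alternatives are decidable.
small-or-large : ∀ x ε → 0ℚ ℚ.< ε → x ≼ fromℚ ε ⊎ fromℚ (ℚ.½ ℚ.* ε) ≼ x
small-or-large x ε 0<ε with cauchy x (ℚ.½ ℚ.* (ℚ.½ ℚ.* ε)) (half (half 0<ε))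
... | N , h = threshold (seq x N ℚ.≤? ℚ.½ ℚ.* ε ℚ.+ q)
  where
  open +-*-Solver
  open ℚP.≤-Reasoning
  q : ℚ
  q = ℚ.½ ℚ.* (ℚ.½ ℚ.* ε)
  -- Terms from `N` on differ by less than `q = ε/4`, so comparing the single rational `seq x N`
  -- with the midpoint `3ε/4` settles one of the two bounds.
  threshold : Dec (seq x N ℚ.≤ ℚ.½ ℚ.* ε ℚ.+ q) → x ≼ fromℚ ε ⊎ fromℚ (ℚ.½ ℚ.* ε) ≼ x
  threshold (yes x≤) = inj₁ (ev≼ (N , λ n N≤n → begin
    seq x n
      ≡⟨ solve 2 (λ a b → a := (a :- b) :+ b) ≡.refl (seq x n) (seq x N) ⟩
    (seq x n ℚ.- seq x N) ℚ.+ seq x N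
      ≤⟨ ℚP.+-mono-≤ (ℚP.≤-trans (p≤∣p∣ _) (ℚP.<⇒≤ (h n N N≤n ℕP.≤-refl))) x≤ ⟩
    q ℚ.+ (ℚ.½ ℚ.* ε ℚ.+ q)
      ≡⟨ solve 1 (λ ε → con ℚ.½ :* (con ℚ.½ :* ε) :+ (con ℚ.½ :* ε :+ con ℚ.½ :* (con ℚ.½ :* ε)) := ε) ≡.refl ε ⟩
    ε ∎))
  threshold (no x≰) = inj₂ (ev≼ (N , λ n N≤n → begin
    ℚ.½ ℚ.* ε
      ≡⟨ solve 2 (λ a b → a := (a :+ b) :- b) ≡.refl (ℚ.½ ℚ.* ε) q ⟩
    (ℚ.½ ℚ.* ε ℚ.+ q) ℚ.- q
      ≤⟨ ℚP.+-mono-≤ (ℚP.<⇒≤ (ℚP.≰⇒> x≰))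
           (ℚP.neg-antimono-≤ (ℚP.≤-trans (p≤∣p∣ _) (ℚP.<⇒≤ (h N n ℕP.≤-refl N≤n)))) ⟩
    seq x N ℚ.- (seq x N ℚ.- seq x n)
      ≡⟨ solve 2 (λ a b → a :- (a :- b) := b) ≡.refl (seq x N) (seq x n) ⟩
    seq x n ∎))

rational-upperBound : ∀ x → ∃ λ K → 0ℚ ℚ.< K × ∣ x ∣ ≼ fromℚ K
rational-upperBound x = let K , 0<K , N , h = eventually-bounded (cauchy x) in
  K , 0<K , ev≼ (N , λ n N≤n → ℚP.<⇒≤ (h n N≤n))

-- Vectors and quadratic forms

sum-mono-≼ : ∀ {n} {v w : Vector ℝ n} → (∀ k → v k ≼ w k) → sum v ≼ sum w
sum-mono-≼ {zero}  h = ≼-refl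
sum-mono-≼ {suc n} h = +-mono-≼ (h Fin.zero) (sum-mono-≼ (h ∘ Fin.suc))

0≼sum : ∀ {n} {v : Vector ℝ n} → (∀ k → 0ℝ ≼ v k) → 0ℝ ≼ sum v
0≼sum {zero}  h = ≼-refl
0≼sum {suc n} h = 0≼+ (h Fin.zero) (0≼sum (h ∘ Fin.suc))

term≼sum : ∀ {n} {v : Vector ℝ n} → (∀ k → 0ℝ ≼ v k) → ∀ k → v k ≼ sum v
term≼sum {suc n} {v} h Fin.zero    = ≼-from (0≼sum (h ∘ Fin.suc)) λ _ → ≡.refl
term≼sum {suc n} {v} h (Fin.suc k) = ≼-trans (term≼sum (h ∘ Fin.suc) k)
  (≼-from (h Fin.zero) λ _ → ℚP.+-comm (seq (sum (v ∘ Fin.suc)) _) (seq (v Fin.zero) _))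

dot-cong : ∀ {n} {u u′ v v′ : Vector ℝ n} → (∀ k → u k ≃ u′ k) → (∀ k → v k ≃ v′ k) → dot u v ≃ dot u′ v′
dot-cong p q = sum-cong-≋ λ k → *-cong (p k) (q k)

0≼dot : ∀ {n} (d : Vector ℝ n) → 0ℝ ≼ dot d d
0≼dot d = 0≼sum λ k → 0≼sq (d k)

dot-congʳ : ∀ {n} (u : Vector ℝ n) {v v′ : Vector ℝ n} → (∀ k → v k ≃ v′ k) → dot u v ≃ dot u v′
dot-congʳ u q = dot-cong {u = u} (λ _ → ≃-refl) q

dot-comm : ∀ {n} (u v : Vector ℝ n) → dot u v ≃ dot v u
dot-comm u v = sum-cong-≋ λ k → *-comm (u k) (v k)

dot-+ʳ : ∀ {n} (u v w : Vector ℝ n) → dot u (λ k → v k + w k) ≃ dot u v + dot u w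
dot-+ʳ u v w = ≃-trans
  (sum-cong-≋ λ k → pw≃ λ l → ℚP.*-distribˡ-+ (seq (u k) l) (seq (v k) l) (seq (w k) l))
  (∑-distrib-+ (λ k → u k * v k) (λ k → u k * w k))

dot-*ʳ : ∀ {n} c (u v : Vector ℝ n) → dot u (λ k → c * v k) ≃ c * dot u v
dot-*ʳ c u v = ≃-trans
  (sum-cong-≋ λ k → pw≃ λ l → solve 3 (λ c a b → a :* (c :* b) := c :* (a :* b))
      ≡.refl (seq c l) (seq (u k) l) (seq (v k) l))
  (≃-sym (*-distribˡ-sum c (λ k → u k * v k)))
  where open +-*-Solver

dot-‿-ʳ : ∀ {n} (u v w : Vector ℝ n) → dot u (λ k → v k - w k) ≃ dot u v - dot u w
dot-‿-ʳ u v w = ≃-trans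
  (dot-congʳ u {v′ = λ k → v k + (- 1ℝ) * w k} λ k → pw≃ λ l →
    solve 2 (λ a b → a :- b := a :+ con (ℚ.- 1ℚ) :* b) ≡.refl (seq (v k) l) (seq (w k) l))
  (≃-trans (dot-+ʳ u v (λ k → (- 1ℝ) * w k))
  (≃-trans (+-cong (≃-refl {dot u v}) (dot-*ʳ (- 1ℝ) u w))
  (pw≃ λ l → solve 2 (λ a b → a :+ con (ℚ.- 1ℚ) :* b := a :- b)
      ≡.refl (seq (dot u v) l) (seq (dot u w) l))))
  where open +-*-Solver

dot-+ˡ : ∀ {n} (u v w : Vector ℝ n) → dot (λ k → v k + w k) u ≃ dot v u + dot w u
dot-+ˡ u v w = ≃-trans (dot-comm _ u) (≃-trans (dot-+ʳ u v w) (+-cong (dot-comm u v) (dot-comm u w)))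

dot-basis : ∀ {n} (v : Vector ℝ n) i → dot v (basis i) ≃ v i
dot-basis {suc n} v Fin.zero = ≃-trans
  (+-cong (*-identityʳ (v Fin.zero)) (≃-trans (sum-cong-≋ λ k → zeroʳ (v (Fin.suc k))) (sum-replicate-zero n)))
  (+-identityʳ (v Fin.zero))
dot-basis {suc n} v (Fin.suc i) = ≃-trans
  (+-cong (zeroʳ (v Fin.zero)) (dot-basis (v ∘ Fin.suc) i)) (+-identityˡ (v (Fin.suc i)))

-- The displacement that moves weight `s` from `j` to `i`, spelled as in `Step` so that the update
-- rule of a run has this form definitionally.
exchange : ∀ {n} → ℝ → Fin n → Fin n → Vector ℝ n
exchange s i j k = s * (basis i k - basis j k)

dot-exchange : ∀ {n} (v : Vector ℝ n) s i j → dot v (exchange s i j) ≃ s * (v i - v j)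
dot-exchange v s i j = ≃-trans (dot-*ʳ s v (λ k → basis i k - basis j k))
  (*-cong (≃-refl {s}) (≃-trans (dot-‿-ʳ v (basis i) (basis j))
    (+-cong (dot-basis v i) (neg-cong (dot-basis v j)))))

quadraticForm-cong : ∀ {n} (A : Matrix n) {v w : Vector ℝ n} → (∀ k → v k ≃ w k) →
                     quadraticForm A v ≃ quadraticForm A w
quadraticForm-cong A h = dot-cong h λ i → dot-congʳ (A i) h

IsSymmetric : ∀ {n} → Matrix n → Set
IsSymmetric A = ∀ i j → A i j ≃ A j i

selfAdjoint : ∀ {n} (A : Matrix n) → IsSymmetric A → (v w : Vector ℝ n) → dot v (A · w) ≃ dot w (A · v)
selfAdjoint A A-sym v w = ≃-trans
  (sum-cong-≋ λ i → *-distribˡ-sum (v i) (λ j → A i j * w j))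
  (≃-trans (∑-comm (λ i j → v i * (A i j * w j)))
  (sum-cong-≋ λ j → ≃-trans
    (sum-cong-≋ λ i → ≃-trans (*-cong (≃-refl {v i}) (*-cong (A-sym i j) (≃-refl {w j})))
      (pw≃ λ l → solve 3 (λ a b c → a :* (b :* c) := c :* (b :* a))
          ≡.refl (seq (v i) l) (seq (A j i) l) (seq (w j) l)))
    (≃-sym (*-distribˡ-sum (w j) (λ i → A j i * v i)))))
  where open +-*-Solver

2ℝ : ℝ
2ℝ = fromℕ 2

quadraticForm-+ : ∀ {n} (A : Matrix n) → IsSymmetric A → (w d : Vector ℝ n) →
  quadraticForm A (λ k → w k + d k) ≃ quadraticForm A w + 2ℝ * dot d (A · w) + quadraticForm A d
quadraticForm-+ A A-sym w d = ≃-trans (dot-+ˡ (A · (λ k → w k + d k)) w d)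
  (≃-trans (+-cong (expand w) (expand d))
  (≃-trans (+-cong (+-cong (≃-refl {quadraticForm A w}) (selfAdjoint A A-sym w d)) ≃-refl)
  (pw≃ λ l → solve 3 (λ a b c → (a :+ b) :+ (b :+ c) := a :+ con (+ 2 ℚ./ 1) :* b :+ c) ≡.refl
     (seq (quadraticForm A w) l) (seq (dot d (A · w)) l) (seq (quadraticForm A d) l))))
  where
  open +-*-Solver
  expand : ∀ u → dot u (A · (λ k → w k + d k)) ≃ dot u (A · w) + dot u (A · d)
  expand u = ≃-trans (dot-congʳ u λ i → dot-+ʳ (A i) w d) (dot-+ʳ u (A · w) (A · d))

-- The exact Taylor expansion at `w`: the gradient is twice `A · w`, and the remainder is the form
-- itself at `v - w`.
quadraticForm-polar : ∀ {n} (A : Matrix n) → IsSymmetric A → (v w : Vector ℝ n) →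
  quadraticForm A v ≃ quadraticForm A w + 2ℝ * dot (λ k → v k - w k) (A · w) + quadraticForm A (λ k → v k - w k)
quadraticForm-polar A A-sym v w = ≃-trans
  (quadraticForm-cong A {w = λ k → w k + (v k - w k)} λ k → pw≃ λ l →
    solve 2 (λ a b → a := b :+ (a :- b)) ≡.refl (seq (v k) l) (seq (w k) l))
  (quadraticForm-+ A A-sym w (λ k → v k - w k))
  where open +-*-Solver

quadraticForm-exchange : ∀ {n} (A : Matrix n) s i j →
  quadraticForm A (exchange s i j) ≃ s * s * (A i i + A j j - A i j - A j i)
quadraticForm-exchange A s i j = ≃-trans (dot-comm _ (A · exchange s i j))
  (≃-trans (dot-exchange (A · exchange s i j) s i j)
  (≃-trans (*-cong (≃-refl {s}) (+-cong (dot-exchange (A i) s i j) (neg-cong (dot-exchange (A j) s i j))))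
  (pw≃ λ l → solve 5 (λ s a b c d → s :* (s :* (a :- b) :- s :* (c :- d)) := s :* s :* (a :+ d :- b :- c)) ≡.refl
    (seq s l) (seq (A i i) l) (seq (A i j) l) (seq (A j i) l) (seq (A j j) l))))
  where open +-*-Solver

-- The matrix `NᵀN`, where `N x` is row `x` of `N`.
gram : ∀ {n p} → (Fin p → Vector ℝ n) → Matrix n
gram N e e′ = sum λ x → N x e * N x e′

-- This is `dᵀNᵀNd = |Nd|²`, reached by moving the sum over `x` outermost; as a sum of squares it is
-- nonnegative.
quadraticForm-gram : ∀ {n p} (N : Fin p → Vector ℝ n) (d : Vector ℝ n) →
  quadraticForm (gram N) d ≃ sum λ x → dot (N x) d * dot (N x) d
quadraticForm-gram N d = ≃-trans
  (dot-congʳ d λ e → ≃-trans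
    (sum-cong-≋ λ e′ → *-distribʳ-sum (d e′) (λ x → N x e * N x e′))
    (≃-trans (∑-comm (λ e′ x → N x e * N x e′ * d e′))
    (sum-cong-≋ λ x → ≃-trans
      (sum-cong-≋ λ e′ → pw≃ λ l → ℚP.*-assoc (seq (N x e) l) (seq (N x e′) l) (seq (d e′) l))
      (≃-sym (*-distribˡ-sum (N x e) (λ e′ → N x e′ * d e′))))))
  (≃-trans (sum-cong-≋ λ e → *-distribˡ-sum (d e) (λ x → N x e * dot (N x) d))
  (≃-trans (∑-comm (λ e x → d e * (N x e * dot (N x) d)))
  (sum-cong-≋ λ x → ≃-trans
    (sum-cong-≋ λ e → pw≃ λ l → solve 3 (λ a b c → a :* (b :* c) := (b :* a) :* c)
        ≡.refl (seq (d e) l) (seq (N x e) l) (seq (dot (N x) d) l))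
    (≃-sym (*-distribʳ-sum (dot (N x) d) (λ e → N x e * d e))))))
  where open +-*-Solver

sum-𝟏 : ∀ n → sum (𝟏 {n}) ≃ fromℕ n
sum-𝟏 zero    = ≃-refl
sum-𝟏 (suc n) = ≃-trans (+-cong (≃-refl {1ℝ}) (sum-𝟏 n)) (pw≃ λ _ → ≡.sym (natℚ-suc n))

-- Line graphs

bracket-yes : ∀ {p} {P : Set p} (d : Dec P) → P → [ d ] ≡ 1ℝ
bracket-yes (yes _) _ = ≡.refl
bracket-yes (no ¬p) p = contradiction p ¬p

bracket-no : ∀ {p} {P : Set p} (d : Dec P) → ¬ P → [ d ] ≡ 0ℝ
bracket-no (yes p) ¬p = contradiction p ¬p
bracket-no (no _)  _  = ≡.refl

bracket-⇔ : ∀ {p q} {P : Set p} {Q : Set q} (d : Dec P) (d′ : Dec Q) → (P → Q) → (Q → P) → [ d ] ≡ [ d′ ]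
bracket-⇔ (yes p) d′ f g = ≡.sym (bracket-yes d′ (f p))
bracket-⇔ (no ¬p) d′ f g = ≡.sym (bracket-no d′ (¬p ∘ g))

0≼bracket : ∀ {p} {P : Set p} (d : Dec P) → 0ℝ ≼ [ d ]
0≼bracket (yes _) = fromℚ-≼ (ℚP.nonNegative⁻¹ 1ℚ)
0≼bracket (no _)  = ≼-refl

bracket≼1 : ∀ {p} {P : Set p} (d : Dec P) → [ d ] ≼ 1ℝ
bracket≼1 (yes _) = ≼-refl
bracket≼1 (no _)  = fromℚ-≼ (ℚP.nonNegative⁻¹ 1ℚ)

lookup-injective : ∀ {a} {A : Set a} {xs : List A} → Unique xs →
  ∀ i j → List.lookup xs i ≡ List.lookup xs j → i ≡ j
lookup-injective (x∉ ∷ u) Fin.zero Fin.zero _ = ≡.refl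
lookup-injective (x∉ ∷ u) Fin.zero (Fin.suc j) e = contradiction e (All.lookup x∉ (∈-lookup j))
lookup-injective (x∉ ∷ u) (Fin.suc i) Fin.zero e = contradiction (≡.sym e) (All.lookup x∉ (∈-lookup i))
lookup-injective (x∉ ∷ u) (Fin.suc i) (Fin.suc j) e = cong Fin.suc (lookup-injective u i j e)

module _ (G : Graph) where
  open Graph G

  endpoint₁ endpoint₂ : E G → Fin order
  endpoint₁ e = proj₁ (List.lookup (edges G) e)
  endpoint₂ e = proj₂ (List.lookup (edges G) e)

  endpoint₁<endpoint₂ : ∀ e → endpoint₁ e Fin.< endpoint₂ e
  endpoint₁<endpoint₂ e = proj₁ (All.lookup
    (AllP.all-filter (λ (u , v) → (u Fin.<? v) ×-dec (u ~? v))
      (List.cartesianProduct (List.allFin order) (List.allFin order)))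
    (∈-lookup {xs = edges G} e))

  -- Edges are positions in a list, so this rests on the list having no repetitions. A repeated pair
  -- would give a Gram entry 2 where `M₂` has 1.
  endpoints-injective : ∀ e e′ → endpoint₁ e ≡ endpoint₁ e′ → endpoint₂ e ≡ endpoint₂ e′ → e ≡ e′
  endpoints-injective e e′ p q = lookup-injective
    (Unique.filter⁺ (λ (u , v) → (u Fin.<? v) ×-dec (u ~? v))
      (Unique.cartesianProduct⁺ (Unique.allFin⁺ order) (Unique.allFin⁺ order)))
    e e′ (×-≡,≡→≡ (p , q))

  -- As a function of `x` this is a sum of two standard basis vectors, so `dot-basis` evaluates the
  -- inner product of two columns.
  incidence : Fin order → Vector ℝ (size G)
  incidence x e = basis (endpoint₁ e) x + basis (endpoint₂ e) x

  gram-incidence : ∀ e e′ → gram incidence e e′ ≃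
    (basis (endpoint₁ e′) (endpoint₁ e) + basis (endpoint₂ e′) (endpoint₁ e)) +
    (basis (endpoint₁ e′) (endpoint₂ e) + basis (endpoint₂ e′) (endpoint₂ e))
  gram-incidence e e′ = ≃-trans (dot-comm (λ x → incidence x e) (λ x → incidence x e′))
    (≃-trans (dot-+ʳ (λ x → incidence x e′) (basis (endpoint₁ e)) (basis (endpoint₂ e)))
    (+-cong (dot-basis (λ x → incidence x e′) (endpoint₁ e)) (dot-basis (λ x → incidence x e′) (endpoint₂ e))))

  -- The Gram entry counts coincidences of endpoints: two for an edge with itself, so 4 = 2 + 2 on
  -- the diagonal, and at most one for distinct edges, which is then their adjacency.
  M₂-gram : ∀ e e′ → M₂ G e e′ ≃ 2ℝ * identity e e′ + gram incidence e e′
  M₂-gram e e′ = ≃-trans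
    (pw≃ (entry (e Fin.≟ e′) (Graph._~?_ (lineGraph G) e e′) (p′ Fin.≟ p) (q′ Fin.≟ p) (p′ Fin.≟ q) (q′ Fin.≟ q)))
    (+-cong (≃-refl {2ℝ * identity e e′}) (≃-sym (gram-incidence e e′)))
    where
    p = endpoint₁ e ; q = endpoint₂ e ; p′ = endpoint₁ e′ ; q′ = endpoint₂ e′
    Adjacent : Set
    Adjacent = Graph._~_ (lineGraph G) e e′
    p≢q : p ≢ q
    p≢q e≡ = FinP.<-irrefl e≡ (endpoint₁<endpoint₂ e)
    p′≢q′ : p′ ≢ q′
    p′≢q′ e≡ = FinP.<-irrefl e≡ (endpoint₁<endpoint₂ e′)
    -- Listing each edge with its smaller endpoint first excludes a second copy in the opposite
    -- orientation.
    not-crossed : p′ ≡ q → ¬ q′ ≡ p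
    not-crossed p′≡q q′≡p = FinP.<-asym (endpoint₁<endpoint₂ e)
      (≡.subst₂ Fin._<_ p′≡q q′≡p (endpoint₁<endpoint₂ e′))
    entry : (same : Dec (e ≡ e′)) (adjacent : Dec Adjacent)
      (a : Dec (p′ ≡ p)) (b : Dec (q′ ≡ p)) (c : Dec (p′ ≡ q)) (d : Dec (q′ ≡ q)) → ∀ l →
      seq (fromℕ 4 * [ same ] + [ adjacent ]) l ≡
      seq (2ℝ * [ same ] + (([ a ] + [ b ]) + ([ c ] + [ d ]))) l
    entry (yes e≡e′) (yes (e≢e′ , _)) a b c d l = contradiction e≡e′ e≢e′
    entry (yes ≡.refl) (no _) a b c d l
      rewrite bracket-yes a ≡.refl | bracket-no b (p≢q ∘ ≡.sym) | bracket-no c p≢q | bracket-yes d ≡.refl = ≡.refl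
    -- The six ways in which distinct edges could have two coincidences are refuted first.
    entry (no e≢e′) adjacent (yes a) (yes b) _ _ l = contradiction (≡.trans a (≡.sym b)) p′≢q′
    entry (no e≢e′) adjacent (yes a) _ (yes c) _ l = contradiction (≡.trans (≡.sym a) c) p≢q
    entry (no e≢e′) adjacent (yes a) _ _ (yes d) l = contradiction (endpoints-injective e e′ (≡.sym a) (≡.sym d)) e≢e′
    entry (no e≢e′) adjacent _ (yes b) (yes c) _ l = contradiction b (not-crossed c)
    entry (no e≢e′) adjacent _ (yes b) _ (yes d) l = contradiction (≡.trans (≡.sym b) d) p≢q
    entry (no e≢e′) adjacent _ _ (yes c) (yes d) l = contradiction (≡.trans c (≡.sym d)) p′≢q′
    entry (no e≢e′) adjacent (yes a) (no _) (no _) (no _) l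
      rewrite bracket-yes adjacent (e≢e′ , p , inj₁ ≡.refl , inj₁ (≡.sym a)) = ≡.refl
    entry (no e≢e′) adjacent (no _) (yes b) (no _) (no _) l
      rewrite bracket-yes adjacent (e≢e′ , p , inj₁ ≡.refl , inj₂ (≡.sym b)) = ≡.refl
    entry (no e≢e′) adjacent (no _) (no _) (yes c) (no _) l
      rewrite bracket-yes adjacent (e≢e′ , q , inj₂ ≡.refl , inj₁ (≡.sym c)) = ≡.refl
    entry (no e≢e′) adjacent (no _) (no _) (no _) (yes d) l
      rewrite bracket-yes adjacent (e≢e′ , q , inj₂ ≡.refl , inj₂ (≡.sym d)) = ≡.refl
    entry (no e≢e′) adjacent (no a) (no b) (no c) (no d) l
      rewrite bracket-no adjacent λ where
        (_ , x , inj₁ x≡p , inj₁ x≡p′) → a (≡.trans (≡.sym x≡p′) x≡p)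
        (_ , x , inj₁ x≡p , inj₂ x≡q′) → b (≡.trans (≡.sym x≡q′) x≡p)
        (_ , x , inj₂ x≡q , inj₁ x≡p′) → c (≡.trans (≡.sym x≡p′) x≡q)
        (_ , x , inj₂ x≡q , inj₂ x≡q′) → d (≡.trans (≡.sym x≡q′) x≡q) = ≡.refl

  M₂-symmetric : IsSymmetric (M₂ G)
  M₂-symmetric e e′ = +-cong
    (*-cong (≃-refl {fromℕ 4}) (≃-reflexive (bracket-⇔ (e Fin.≟ e′) (e′ Fin.≟ e) ≡.sym ≡.sym)))
    (≃-reflexive (bracket-⇔ (Graph._~?_ (lineGraph G) e e′) (Graph._~?_ (lineGraph G) e′ e)
      (Graph.symm (lineGraph G) {e} {e′}) (Graph.symm (lineGraph G) {e′} {e})))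

  M₂-diagonal : ∀ e → M₂ G e e ≃ fromℕ 4
  M₂-diagonal e = ≃-trans
    (+-cong (*-cong (≃-refl {fromℕ 4}) (≃-reflexive (bracket-yes (e Fin.≟ e) ≡.refl)))
      (≃-reflexive (bracket-no (Graph._~?_ (lineGraph G) e e) λ (e≢e , _) → e≢e ≡.refl)))
    (pw≃ λ _ → ≡.refl)

  0≼M₂ : ∀ e e′ → 0ℝ ≼ M₂ G e e′
  0≼M₂ e e′ = 0≼+ (0≼* (fromℚ-≼ (ℚP.nonNegative⁻¹ (+ 4 ℚ./ 1))) (0≼bracket (e Fin.≟ e′)))
                  (0≼bracket (Graph._~?_ (lineGraph G) e e′))

  -- The brackets give 4 + 1 = 5; rounding up to 8 cancels the factor 1/8 in `t` and yields `t≼m`.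
  M₂≼8 : ∀ e e′ → M₂ G e e′ ≼ fromℕ 8
  M₂≼8 e e′ = ≼-trans
    (+-mono-≼ (*-monoˡ-≼ (fromℚ-≼ (ℚP.nonNegative⁻¹ (+ 4 ℚ./ 1))) (bracket≼1 (e Fin.≟ e′)))
              (bracket≼1 (Graph._~?_ (lineGraph G) e e′)))
    (pw≼ λ _ → ℚP.≤ᵇ⇒≤ _)

  -- The certificate is `|Nd|²`, the Gram part of the form. The constant 2 is the modulus of strong
  -- convexity in everything that follows.
  M₂-lowerBound : ∀ d → 2ℝ * dot d d ≼ f G d
  M₂-lowerBound d = ≼-resp ≃-refl (≃-sym form)
      (≼-from (0≼sum λ x → 0≼sq (dot (incidence x) d)) λ _ → ≡.refl)
    where
    form : f G d ≃ 2ℝ * dot d d + sum λ x → dot (incidence x) d * dot (incidence x) d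
    form = ≃-trans
      (dot-congʳ d λ e → ≃-trans
        (dot-cong {v = d} (M₂-gram e) (λ _ → ≃-refl))
        (≃-trans (dot-+ˡ d (λ e′ → 2ℝ * identity e e′) (gram incidence e))
        (+-cong (≃-trans (dot-comm _ d) (≃-trans (dot-*ʳ 2ℝ d (identity e)) (*-cong (≃-refl {2ℝ}) (dot-basis d e))))
                (≃-refl {(gram incidence · d) e}))))
      (≃-trans (dot-+ʳ d (λ e → 2ℝ * d e) (gram incidence · d))
        (+-cong (dot-*ʳ 2ℝ d d) (quadraticForm-gram incidence d)))

-- One step of the procedure

open import Relation.Binary.Reasoning.PartialOrder ≼-poset

x⊓y≼x : ∀ {x y} → x ⊓ y ≼ x
x⊓y≼x {x} {y} = pw≼ λ k → ℚP.p⊓q≤p (seq x k) (seq y k)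

x⊓y≼y : ∀ {x y} → x ⊓ y ≼ y
x⊓y≼y {x} {y} = pw≼ λ k → ℚP.p⊓q≤q (seq x k) (seq y k)

⊓-glb-≼ : ∀ {x y z} → z ≼ x → z ≼ y → z ≼ x ⊓ y
⊓-glb-≼ {x} {y} {z} (mk≼ h) (mk≼ h′) = mk≼ λ ε 0<ε →
  let N₁ , h₁ = h ε 0<ε
      N₂ , h₂ = h′ ε 0<ε
  in N₁ ℕ.⊔ N₂ , λ n p → case-⊓ (seq x n) (seq y n) (h₁ n (⊔ˡ N₁ N₂ p)) (h₂ n (⊔ʳ N₁ N₂ p))
  where
  case-⊓ : ∀ a b {c ε} → c ℚ.< a ℚ.+ ε → c ℚ.< b ℚ.+ ε → c ℚ.< (a ℚ.⊓ b) ℚ.+ ε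
  case-⊓ a b p q with ℚP.⊓-sel a b
  ... | inj₁ e rewrite e = p
  ... | inj₂ e rewrite e = q

-- x y = min(x,y) max(x,y), with the maximum written as x + y - min(x,y).
⊓-product : ∀ x y → x * y ≃ (x ⊓ y) * (x + y - x ⊓ y)
⊓-product x y = pw≃ λ k → go (seq x k) (seq y k)
  where
  open +-*-Solver
  go : ∀ a b → a ℚ.* b ≡ (a ℚ.⊓ b) ℚ.* (a ℚ.+ b ℚ.- (a ℚ.⊓ b))
  go a b with ℚP.⊓-sel a b
  ... | inj₁ e rewrite e = solve 2 (λ a b → a :* b := a :* (a :+ b :- a)) ≡.refl a b
  ... | inj₂ e rewrite e = solve 2 (λ a b → a :* b := b :* (a :+ b :- b)) ≡.refl a b

-- With `η = x ⊓ y`, `⊓-product` turns the difference of the two sides into `(s - η)(x + y) + η²`.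
*≼⊓-bound : ∀ {x y s} → 0ℝ ≼ x → 0ℝ ≼ y → x ⊓ y ≼ s → x * y ≼ s * (x + y)
*≼⊓-bound {x} {y} {s} 0≼x 0≼y h = ≼-resp (≃-sym (⊓-product x y)) ≃-refl
  (≼-from (0≼+ (0≼* (≼⇒0≼ h) (0≼+ 0≼x 0≼y)) (0≼sq (x ⊓ y))) λ k →
    solve 4 (λ x y s η → η :* (x :+ y :- η) :+ ((s :- η) :* (x :+ y) :+ η :* η) := s :* (x :+ y)) ≡.refl
      (seq x k) (seq y k) (seq s k) (seq (x ⊓ y) k))
  where open +-*-Solver

sum-dot-𝟏 : ∀ {n} (v : Vector ℝ n) → dot 𝟏 v ≃ sum v
sum-dot-𝟏 v = sum-cong-≋ λ k → *-identityˡ (v k)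

-- For `c = g i` and `e = 1/8` the left vector is `t w i`. The shift by `c` enters only through
-- `sum u`, which is the same for all feasible `u`.
dot-affine : ∀ {n} (u g : Vector ℝ n) c e → dot u (λ k → (g k - c) * e) ≃ (dot u g - sum u * c) * e
dot-affine u g c e = begin-equality
  dot u (λ k → (g k - c) * e)       ≈⟨ dot-congʳ u (λ k → *-comm (g k - c) e) ⟩
  dot u (λ k → e * (g k - c))       ≈⟨ dot-*ʳ e u (λ k → g k - c) ⟩
  e * dot u (λ k → g k - c)         ≈⟨ *-comm e _ ⟩
  dot u (λ k → g k - c) * e         ≈⟨ *-cong (dot-‿-ʳ u g (λ _ → c)) (≃-refl {e}) ⟩
  (dot u g - dot u (λ _ → c)) * e
    ≈⟨ *-cong (+-cong (≃-refl {dot u g}) (neg-cong (*-distribʳ-sum c u))) (≃-refl {e}) ⟨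
  (dot u g - sum u * c) * e         ∎

module _ (G : Graph) where

  -- Membership in `R`, restated with the wrappers and a plain sum.
  record Feasible (w : Vector ℝ (size G)) : Set where
    field
      total : sum w ≃ fromℕ (size G)
      0≼    : ∀ k → 0ℝ ≼ w k

  open Feasible public

  R⇒feasible : ∀ {w} → R G w → Feasible w
  R⇒feasible {w} (Σw , 0≤w) =
      record { total = ≃-trans (≃-sym (sum-dot-𝟏 w)) (mk≃ Σw) ; 0≼ = λ k → mk≼ (0≤w k) }

  feasible⇒R : ∀ {w} → Feasible w → R G w
  feasible⇒R {w} F = get≃ (≃-trans (sum-dot-𝟏 w) (total F)) , λ k → get≼ (0≼ F k)

  m : ℝ
  m = fromℕ (size G)

  gradient≼ : ∀ {w} → Feasible w → ∀ k → (M₂ G · w) k ≼ fromℕ 8 * m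
  gradient≼ {w} F k = begin
    (M₂ G · w) k
      ≤⟨ sum-mono-≼ (λ l → ≼-resp (*-comm (w l) _) (*-comm (w l) _) (*-monoˡ-≼ (0≼ F l) (M₂≼8 G k l))) ⟩
    (sum λ l → fromℕ 8 * w l)    ≈⟨ *-distribˡ-sum (fromℕ 8) w ⟨
    fromℕ 8 * sum w              ≈⟨ *-cong (≃-refl {fromℕ 8}) (total F) ⟩
    fromℕ 8 * m                  ∎

  0≼gradient : ∀ {w} → Feasible w → ∀ k → 0ℝ ≼ (M₂ G · w) k
  0≼gradient F k = 0≼sum λ l → 0≼* (0≼M₂ G k l) (0≼ F l)

  module _ {w : Vector ℝ (size G)} (F : Feasible w) (i : E G) (i-min : ∀ k → (M₂ G · w) i ≼ (M₂ G · w) k) where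
    private
      g : Vector ℝ (size G)
      g = M₂ G · w

    0≼t : ∀ k → 0ℝ ≼ t G w i k
    0≼t k = 0≼* (≼⇒0≼ (i-min k)) (fromℚ-≼ (ℚP.nonNegative⁻¹ (+ 1 ℚ./ 8)))

    t≼m : ∀ k → t G w i k ≼ m
    t≼m k =
        ≼-from (0≼* (0≼+ (≼⇒0≼ (gradient≼ F k)) (0≼gradient F i)) (fromℚ-≼ (ℚP.nonNegative⁻¹ (+ 1 ℚ./ 8))))
      λ l → solve 3 (λ gk gi m →
          (gk :- gi) :* con (+ 1 ℚ./ 8) :+ (con (+ 8 ℚ./ 1) :* m :- gk :+ gi) :* con (+ 1 ℚ./ 8) := m) ≡.refl
        (seq (g k) l) (seq (g i) l) (seq m l)
      where open +-*-Solver

    module _ (j : E G) (j-max : ∀ k → η G w i k ≼ η G w i j) where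
      private
        s : ℝ
        s = η G w i j

      -- The index `i` is itself a candidate for `j`, and its own `η` is nonnegative.
      0≼η : 0ℝ ≼ s
      0≼η = ≼-trans (⊓-glb-≼ (0≼t i) (0≼ F i)) (j-max i)

      -- The Frank–Wolfe gap at w, up to a factor.
      gap≼ : dot w (t G w i) ≼ s * (m * m + m)
      gap≼ = begin
        dot w (t G w i)                           ≈⟨ dot-comm w (t G w i) ⟩
        dot (t G w i) w
          ≤⟨ sum-mono-≼ (λ k → *≼⊓-bound (0≼t k) (0≼ F k) (j-max k)) ⟩
        (sum λ k → s * (t G w i k + w k))         ≈⟨ *-distribˡ-sum s (λ k → t G w i k + w k) ⟨
        s * (sum λ k → t G w i k + w k)           ≤⟨ *-monoˡ-≼ 0≼η bound ⟩
        s * (m * m + m)                           ∎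
        where
        bound : (sum λ k → t G w i k + w k) ≼ m * m + m
        bound = begin
          (sum λ k → t G w i k + w k)           ≈⟨ ∑-distrib-+ (t G w i) w ⟩
          sum (t G w i) + sum w
            ≤⟨ +-mono-≼ (sum-mono-≼ λ k → ≼-trans (t≼m k) (≃⇒≼ (≃-sym (*-identityʳ m)))) (≃⇒≼ (total F)) ⟩
          (sum {size G} λ k → m * 𝟏 k) + m      ≈⟨ +-cong (*-distribˡ-sum {size G} m 𝟏) (≃-refl {m}) ⟨
          m * sum (𝟏 {size G}) + m
            ≈⟨ +-cong (*-cong (≃-refl {m}) (sum-𝟏 (size G))) (≃-refl {m}) ⟩
          m * m + m                             ∎

      -- For `d = v - w` the expansion reads `f v - f w = 16 (v·t - w·t) + f d`, with 16 = 2 · 8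
      -- from the gradient and from `t`. Now `v·t ≥ 0`, `w·t` is bounded by `gap≼`, and of
      -- `f d ≥ 2|d|²` one `|d|²` is kept.
      distance≼ : ∀ {v} → Feasible v →
        dot (λ k → v k - w k) (λ k → v k - w k) ≼ f G v - f G w + fromℕ 16 * (s * (m * m + m))
      distance≼ {v} Fv = ≼-resp ≃-refl
        (+-cong (+-cong (≃-sym expand) (≃-refl { - f G w})) ≃-refl)
        (≼-from (0≼+ (0≼+ (≼⇒0≼ (M₂-lowerBound G d)) (0≼dot d))
                     (0≼* (0≼fromℕ 16) (0≼+ (0≼sum λ k → 0≼* (0≼ Fv k) (0≼t k)) (≼⇒0≼ gap≼))))
          λ l → solve 6 (λ dd fw a b q B →
              dd :+ ((q :- con (+ 2 ℚ./ 1) :* dd) :+ dd :+ con (+ 16 ℚ./ 1) :* (a :+ (B :- b)))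
              := (fw :+ con (+ 2 ℚ./ 1) :* (con (+ 8 ℚ./ 1) :* (a :- b)) :+ q) :- fw :+ con (+ 16 ℚ./ 1) :* B) ≡.refl
            (seq (dot d d) l) (seq (f G w) l) (seq (dot v (t G w i)) l) (seq (dot w (t G w i)) l) (seq (f G d) l)
            (seq (s * (m * m + m)) l))
        where
        open +-*-Solver
        d : Vector ℝ (size G)
        d k = v k - w k
        slope : dot d g ≃ fromℕ 8 * (dot v (t G w i) - dot w (t G w i))
        slope = begin-equality
          dot d g                  ≈⟨ dot-comm d g ⟩
          dot g d                  ≈⟨ dot-‿-ʳ g v w ⟩
          dot g v - dot g w        ≈⟨ +-cong (dot-comm g v) (neg-cong (dot-comm g w)) ⟩
          dot v g - dot w g
            -- Both totals equal `m`, so `m * g i` can be subtracted from both terms; this turns the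
            -- gradient into multiples of `t`.
            ≈⟨ pw≃ (λ l → solve 4 (λ a b σ c → a :- b :=
                  con (+ 8 ℚ./ 1) :* ((a :- σ :* c) :* con (+ 1 ℚ./ 8) :- (b :- σ :* c) :* con (+ 1 ℚ./ 8))) ≡.refl
                                      (seq (dot v g) l) (seq (dot w g) l) (seq m l) (seq (g i) l)) ⟩
          fromℕ 8 * ((dot v g - m * g i) * fromℚ (+ 1 ℚ./ 8) - (dot w g - m * g i) * fromℚ (+ 1 ℚ./ 8))
            ≈⟨ *-cong (≃-refl {fromℕ 8}) (+-cong (with-total v Fv) (neg-cong (with-total w F))) ⟩
          fromℕ 8 * (dot v (t G w i) - dot w (t G w i)) ∎
          where
          with-total : ∀ u → Feasible u → (dot u g - m * g i) * fromℚ (+ 1 ℚ./ 8) ≃ dot u (t G w i)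
          with-total u Fu = ≃-trans
            (*-cong (+-cong (≃-refl {dot u g}) (neg-cong (*-cong (≃-sym (total Fu)) (≃-refl {g i})))) (≃-refl {fromℚ (+ 1 ℚ./ 8)}))
            (≃-sym (dot-affine u g (g i) (fromℚ (+ 1 ℚ./ 8))))
        expand : f G v ≃ f G w + 2ℝ * (fromℕ 8 * (dot v (t G w i) - dot w (t G w i))) + f G d
        expand = ≃-trans (quadraticForm-polar (M₂ G) (M₂-symmetric G) v w)
          (+-cong (+-cong (≃-refl {f G w}) (*-cong (≃-refl {2ℝ}) slope)) (≃-refl {f G d}))

      module _ {w′ : Vector ℝ (size G)} (w′≃ : ∀ k → w′ k ≃ w k + exchange s i j k) where

        feasible-step : Feasible w′
        feasible-step = record
          { total = begin-equality
              sum w′                                        ≈⟨ sum-cong-≋ w′≃ ⟩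
              sum (λ k → w k + exchange s i j k)            ≈⟨ ∑-distrib-+ w (exchange s i j) ⟩
              sum w + sum (exchange s i j)
                ≈⟨ +-cong (total F) (≃-trans (≃-sym (sum-dot-𝟏 (exchange s i j))) (dot-exchange 𝟏 s i j)) ⟩
              m + s * (1ℝ - 1ℝ)
                ≈⟨ pw≃ (λ l → solve 2 (λ m s → m :+ s :* (con 1ℚ :- con 1ℚ) := m) ≡.refl (seq m l) (seq s l)) ⟩
              m                                             ∎
          ; 0≼ = λ k → ≼-resp ≃-refl (≃-sym (w′≃ k)) (nonneg k (i Fin.≟ k) (j Fin.≟ k)) }
          where
          open +-*-Solver
          nonneg : ∀ k (a : Dec (i ≡ k)) (b : Dec (j ≡ k)) → 0ℝ ≼ w k + s * ([ a ] - [ b ])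
          nonneg k (yes _) (yes _) = ≼-trans (0≼ F k) (≃⇒≼ (pw≃ λ l →
            solve 2 (λ w s → w := w :+ s :* (con 1ℚ :- con 1ℚ)) ≡.refl (seq (w k) l) (seq s l)))
          nonneg k (yes _) (no _) = ≼-trans (0≼+ (0≼ F k) 0≼η) (≃⇒≼ (pw≃ λ l →
            solve 2 (λ w s → w :+ s := w :+ s :* (con 1ℚ :- con 0ℚ)) ≡.refl (seq (w k) l) (seq s l)))
          -- Only coordinate `j` can lose weight, and it loses `s ≤ w j`.
          nonneg k (no _) (yes ≡.refl) = ≼-trans (≼⇒0≼ (x⊓y≼y {t G w i k} {w k})) (≃⇒≼ (pw≃ λ l →
            solve 2 (λ w s → w :- s := w :+ s :* (con 0ℚ :- con 1ℚ)) ≡.refl (seq (w k) l) (seq s l)))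
          nonneg k (no _) (no _) = ≼-trans (0≼ F k) (≃⇒≼ (pw≃ λ l →
            solve 2 (λ w s → w := w :+ s :* (con 0ℚ :- con 0ℚ)) ≡.refl (seq (w k) l) (seq s l)))

        descent : f G w′ + s * s ≼ f G w
        descent = ≼-trans (+-mono-≼ (≃⇒≼ expand) (≼-refl {s * s}))
          -- The linear term gains `16 s t_j ≥ 16 s²` and the diagonal costs `8 s²`; of the
          -- remaining `8 s²`, one `s²` is claimed and seven are discarded.
          (≼-from (0≼+ (0≼+ (0≼* (0≼fromℕ 16) (0≼* 0≼η (≼⇒0≼ (x⊓y≼x {t G w i j} {w j}))))
                            (0≼* (0≼sq s) (0≼+ (0≼M₂ G i j) (0≼M₂ G j i))))
                       (0≼* (0≼fromℕ 7) (0≼sq s)))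
            λ l → solve 6 (λ fw s gi gj a b →
                (fw :+ con (+ 2 ℚ./ 1) :* (s :* (gi :- gj))
                  :+ s :* s :* (con (+ 4 ℚ./ 1) :+ con (+ 4 ℚ./ 1) :- a :- b) :+ s :* s)
                  :+ (con (+ 16 ℚ./ 1) :* (s :* ((gj :- gi) :* con (+ 1 ℚ./ 8) :- s)) :+ (s :* s) :* (a :+ b)
                     :+ con (+ 7 ℚ./ 1) :* (s :* s))
                := fw) ≡.refl
              (seq (f G w) l) (seq s l) (seq (g i) l) (seq (g j) l) (seq (M₂ G i j) l) (seq (M₂ G j i) l))
          where
          open +-*-Solver
          expand : f G w′ ≃ f G w + 2ℝ * (s * (g i - g j)) + s * s * (fromℕ 4 + fromℕ 4 - M₂ G i j - M₂ G j i)
          expand = begin-equality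
            f G w′ ≈⟨ quadraticForm-cong (M₂ G) w′≃ ⟩
            f G (λ k → w k + exchange s i j k) ≈⟨ quadraticForm-+ (M₂ G) (M₂-symmetric G) w (exchange s i j) ⟩
            f G w + 2ℝ * dot (exchange s i j) g + f G (exchange s i j)
              ≈⟨ +-cong (+-cong (≃-refl {f G w}) (*-cong (≃-refl {2ℝ})
                     (≃-trans (dot-comm (exchange s i j) g) (dot-exchange g s i j))))
                   (≃-trans (quadraticForm-exchange (M₂ G) s i j)
                     (*-cong (≃-refl {s * s}) (+-cong (+-cong (+-cong (M₂-diagonal G i) (M₂-diagonal G j)) ≃-refl) ≃-refl))) ⟩
            f G w + 2ℝ * (s * (g i - g j)) + s * s * (fromℕ 4 + fromℕ 4 - M₂ G i j - M₂ G j i) ∎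

-- Limits

x≼∣x∣ : ∀ {x} → x ≼ ∣ x ∣
x≼∣x∣ {x} = pw≼ λ k → p≤∣p∣ (seq x k)

-- Each index without `P` costs at least `c` of a nonnegative quantity, so a search of length about
-- `a 0 / c`, computable in advance, must succeed.
find : ∀ {p} (a : ℕ → ℝ) (P : ℕ → Set p) c → 0ℚ ℚ.< c → (∀ n → 0ℝ ≼ a n) →
  (∀ n → P n ⊎ a (suc n) + fromℚ c ≼ a n) → ∃ P
find a P c 0<c 0≼a step =
  let K , 0<K , a0≼K = rational-upperBound (a 0)
      N , K≤ = archimedes K c 0<K 0<c
  in go N 0 (≼-trans x≼∣x∣ (≼-trans a0≼K (fromℚ-≼ K≤)))
  where
  go : ∀ N n → a n ≼ fromℚ (c ℚ.* natℚ N) → ∃ P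
  go N n h with step n
  go N n h | inj₁ Pn = n , Pn
  -- The budget is spent: `a n ≤ 0`, yet this step would still take `c > 0` from it.
  go zero n h | inj₂ d = contradiction ≡.refl (flip ℚP.<-irrefl
    (ℚP.<-≤-trans 0<c (fromℚ-cancel-≼ (begin
    fromℚ c               ≤⟨ ≼-from (0≼a (suc n)) (λ l → ℚP.+-comm c _) ⟩
    a (suc n) + fromℚ c   ≤⟨ ≼-trans d h ⟩
    fromℚ (c ℚ.* natℚ 0)  ≈⟨ pw≃ (λ _ → ℚP.*-zeroʳ c) ⟩
    0ℝ                    ∎))))
  go (suc N) n h | inj₂ d = go N (suc n) (≼-from (≼⇒0≼ (≼-trans d h)) λ l → ≡.trans
    (cong (λ z → seq (a (suc n)) l ℚ.+ (c ℚ.* z ℚ.- (seq (a (suc n)) l ℚ.+ c))) (natℚ-suc N))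
    (solve 3 (λ a c n → a :+ (c :* (con 1ℚ :+ n) :- (a :+ c)) := c :* n)
        ≡.refl (seq (a (suc n)) l) c (natℚ N)))
    where open +-*-Solver

-- Square roots are avoided by using the hypothesis with tolerance `δ²`, since `ε² + δ² < (ε + δ)²`.
sq≼⇒∣∣≼ : ∀ {x ε} → 0ℚ ℚ.< ε → x * x ≼ fromℚ (ε ℚ.* ε) → ∣ x ∣ ≼ fromℚ ε
sq≼⇒∣∣≼ {x} {ε} 0<ε (mk≼ h) = mk≼ λ δ 0<δ →
  let N , h′ = h (δ ℚ.* δ) (0<* 0<δ 0<δ) in N , λ n N≤n → root (seq x n) δ 0<δ (h′ n N≤n)
  where
  open +-*-Solver
  ∣a∣²≡a² : ∀ a → ℚ.∣ a ∣ ℚ.* ℚ.∣ a ∣ ≡ a ℚ.* a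
  ∣a∣²≡a² a with ℚP.∣p∣≡p∨∣p∣≡-p a
  ... | inj₁ e rewrite e = ≡.refl
  ... | inj₂ e rewrite e = solve 1 (λ a → (:- a) :* (:- a) := a :* a) ≡.refl a
  square-mono : ∀ {a b} → 0ℚ ℚ.< a → a ℚ.≤ b → a ℚ.* a ℚ.≤ b ℚ.* b
  square-mono {a} {b} 0<a a≤b = ℚP.≤-trans
    (ℚP.*-monoˡ-≤-nonNeg a {{ℚ.nonNegative (ℚP.<⇒≤ 0<a)}} a≤b)
    (ℚP.*-monoʳ-≤-nonNeg b {{ℚ.nonNegative (ℚP.≤-trans (ℚP.<⇒≤ 0<a) a≤b)}} a≤b)
  root : ∀ a δ → 0ℚ ℚ.< δ → a ℚ.* a ℚ.< ε ℚ.* ε ℚ.+ δ ℚ.* δ → ℚ.∣ a ∣ ℚ.< ε ℚ.+ δ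
  root a δ 0<δ a²< with ℚ.∣ a ∣ ℚ.<? ε ℚ.+ δ
  ... | yes p = p
  ... | no ≮ = contradiction
    (ℚP.<-≤-trans (ℚP.<-trans a²< expand)
      (subst ((ε ℚ.+ δ) ℚ.* (ε ℚ.+ δ) ℚ.≤_) (∣a∣²≡a² a) (square-mono (ℚP.+-mono-< 0<ε 0<δ) (ℚP.≮⇒≥ ≮))))
    (ℚP.<-irrefl ≡.refl)
    where
    expand : ε ℚ.* ε ℚ.+ δ ℚ.* δ ℚ.< (ε ℚ.+ δ) ℚ.* (ε ℚ.+ δ)
    expand = ≡.subst₂ ℚ._<_ (ℚP.+-identityʳ _)
      (solve 2 (λ ε δ → ε :* ε :+ δ :* δ :+ (ε :* δ :+ ε :* δ) := (ε :+ δ) :* (ε :+ δ)) ≡.refl ε δ)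
      (ℚP.+-monoʳ-< (ε ℚ.* ε ℚ.+ δ ℚ.* δ) (ℚP.+-mono-< (0<* 0<ε 0<δ) (0<* 0<ε 0<δ)))

∣∣-triangle : ∀ x y z → ∣ x - z ∣ ≼ ∣ x - y ∣ + ∣ y - z ∣
∣∣-triangle x y z = pw≼ λ k → subst (λ q → ℚ.∣ q ∣ ℚ.≤ seq (∣ x - y ∣ + ∣ y - z ∣) k)
  (solve 3 (λ a b c → (a :- b) :+ (b :- c) := a :- c) ≡.refl (seq x k) (seq y k) (seq z k))
  (ℚP.∣p+q∣≤∣p∣+∣q∣ (seq x k ℚ.- seq y k) (seq y k ℚ.- seq z k))
  where open +-*-Solver

∣∣-triangle-≼ : ∀ {x} y {z p q} → ∣ x - y ∣ ≼ fromℚ p → ∣ y - z ∣ ≼ fromℚ q → ∣ x - z ∣ ≼ fromℚ (p ℚ.+ q)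
∣∣-triangle-≼ {x} y {z} h h′ = ≼-trans (∣∣-triangle x y z) (≼-trans (+-mono-≼ h h′) (pw≼ λ _ → ℚP.≤-refl))

∣∣-swap : ∀ {x y z} → ∣ x - y ∣ ≼ z → ∣ y - x ∣ ≼ z
∣∣-swap {x} {y} = ≼-trans (pw≼ λ k → ℚP.≤-reflexive (∣-∣-sym (seq y k) (seq x k)))

≼-limit : ∀ {x y} → (∀ ε → 0ℚ ℚ.< ε → x ≼ y + fromℚ ε) → x ≼ y
≼-limit {x} {y} h = mk≼ λ ε 0<ε →
  let N , h′ = get≼ (h (ℚ.½ ℚ.* ε) (half 0<ε)) (ℚ.½ ℚ.* ε) (half 0<ε)
  in N , λ n N≤n → subst (seq x n ℚ.<_)
    (≡.trans (ℚP.+-assoc (seq y n) _ _) (cong (seq y n ℚ.+_) (halves ε))) (h′ n N≤n)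

∣∣≼⇒≼ : ∀ {x y z} → ∣ x - y ∣ ≼ z → x ≼ y + z
∣∣≼⇒≼ {x} {y} {z} h = ≼-from (≼⇒0≼ (≼-trans x≼∣x∣ h))
  λ k → solve 3 (λ x y z → x :+ (z :- (x :- y)) := y :+ z) ≡.refl (seq x k) (seq y k) (seq z k)
  where open +-*-Solver

∣∣≼⇒≃ : ∀ {x y} → (∀ ε → 0ℚ ℚ.< ε → ∣ x - y ∣ ≼ fromℚ ε) → x ≃ y
∣∣≼⇒≃ {x} {y} h = ≼-antisym (≼-limit λ ε 0<ε → ∣∣≼⇒≼ (h ε 0<ε))
                            (≼-limit λ ε 0<ε → ∣∣≼⇒≼ (∣∣-swap {x} {y} (h ε 0<ε)))

-- Rational tolerances and a weak inequality let estimates be chained; `rational-below` later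
-- recovers the real tolerance and strict inequality of `_⟶_`.
_⇝_ : (ℕ → ℝ) → ℝ → Set
x ⇝ y = ∀ ε → 0ℚ ℚ.< ε → ∃ λ N → ∀ p → N ℕ.≤ p → ∣ x p - y ∣ ≼ fromℚ ε

-- Completeness of the reals

reciprocal : ∀ n → ∃ λ u → 0ℚ ℚ.< u × natℚ (suc n) ℚ.* u ≡ 1ℚ
reciprocal n = quotient (natℚ (suc n)) 1ℚ (0<natℚ-suc n) (ℚP.positive⁻¹ 1ℚ)

reciprocal-null : ∀ e → 0ℚ ℚ.< e → ∃ λ N → ∀ n → N ℕ.≤ n → proj₁ (reciprocal n) ℚ.≤ e
reciprocal-null e 0<e with archimedes 1ℚ e (ℚP.positive⁻¹ 1ℚ) 0<e
... | N , 1≤eN = N , λ n N≤n → let u , _ , Mu≡1 = reciprocal n in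
  ℚP.*-cancelˡ-≤-pos (natℚ (suc n)) {{ℚ.positive (0<natℚ-suc n)}}
    (subst (ℚ._≤ natℚ (suc n) ℚ.* e) (≡.sym Mu≡1)
      (ℚP.≤-trans 1≤eN (subst (e ℚ.* natℚ N ℚ.≤_) (ℚP.*-comm e _)
        (ℚP.*-monoˡ-≤-nonNeg e {{ℚ.nonNegative (ℚP.<⇒≤ 0<e)}} (natℚ-mono (ℕP.m≤n⇒m≤1+n N≤n))))))

rational-approximation : ∀ x ε → 0ℚ ℚ.< ε → ∃ λ q → ∣ x - fromℚ q ∣ ≼ fromℚ ε
rational-approximation x ε 0<ε = let N , h = cauchy x ε 0<ε in
  seq x N , ev≼ (N , λ n N≤n → ℚP.<⇒≤ (h n N N≤n ℕP.≤-refl))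

-- A diagonal construction: the `n`-th rational of the limit approximates, within `u n = 1/(n+1)`, a
-- term of `x` from which the tail strays by at most `u n`.
module Completeness (x : ℕ → ℝ)
  (x-cauchy : ∀ ε → 0ℚ ℚ.< ε → ∃ λ N → ∀ p → N ℕ.≤ p → ∣ x p - x N ∣ ≼ fromℚ ε) where

  private
    u : ℕ → ℚ
    u n = proj₁ (reciprocal n)

    0<u : ∀ n → 0ℚ ℚ.< u n
    0<u n = proj₁ (proj₂ (reciprocal n))

    index : ℕ → ℕ
    index n = proj₁ (x-cauchy (u n) (0<u n))

    q : ℕ → ℚ
    q n = proj₁ (rational-approximation (x (index n)) (u n) (0<u n))

    q-close : ∀ n p → index n ℕ.≤ p → ∣ x p - fromℚ (q n) ∣ ≼ fromℚ (u n ℚ.+ u n)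
    q-close n p h = ∣∣-triangle-≼ (x (index n)) (proj₂ (x-cauchy (u n) (0<u n)) p h)
      (proj₂ (rational-approximation (x (index n)) (u n) (0<u n)))

    q-diff : ∀ n k → ℚ.∣ q n ℚ.- q k ∣ ℚ.≤ (u n ℚ.+ u n) ℚ.+ (u k ℚ.+ u k)
    q-diff n k = fromℚ-cancel-≼ (≼-trans (pw≼ λ _ → ℚP.≤-refl)
      (∣∣-triangle-≼ {fromℚ (q n)} (x p) {fromℚ (q k)}
        (∣∣-swap {x p} (q-close n p (ℕP.m≤m⊔n (index n) (index k))))
        (q-close k p (ℕP.m≤n⊔m (index n) (index k)))))
      where p = index n ℕ.⊔ index k

    -- Errors add up to `4e` in `q-cauchy` and to `6e` in `limit-⇝`; eight covers both with room for
    -- strictness.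
    eighth : ∀ ε → 0ℚ ℚ.< ε → ∃ λ e → 0ℚ ℚ.< e × (+ 8 ℚ./ 1) ℚ.* e ≡ ε
    eighth ε 0<ε = quotient (+ 8 ℚ./ 1) ε (ℚP.positive⁻¹ (+ 8 ℚ./ 1)) 0<ε

    q-cauchy : Cauchy q
    q-cauchy ε 0<ε =
      let e , 0<e , 8e≡ε = eighth ε 0<ε
          N , h = reciprocal-null e 0<e
      in N , λ n k p r → ℚP.≤-<-trans (q-diff n k) (ℚP.≤-<-trans
           (ℚP.+-mono-≤ (ℚP.+-mono-≤ (h n p) (h n p)) (ℚP.+-mono-≤ (h k r) (h k r)))
           (≡.subst₂ ℚ._<_ (ℚP.+-identityʳ _)
             (≡.trans (solve 1 (λ e → e :+ e :+ (e :+ e) :+ (e :+ e :+ (e :+ e)) := con (+ 8 ℚ./ 1) :* e) ≡.refl e) 8e≡ε)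
             (ℚP.+-monoʳ-< (e ℚ.+ e ℚ.+ (e ℚ.+ e)) (ℚP.+-mono-< (ℚP.+-mono-< 0<e 0<e) (ℚP.+-mono-< 0<e 0<e)))))
      where open +-*-Solver

  limit : ℝ
  limit = mkℝ q q-cauchy

  limit-⇝ : x ⇝ limit
  limit-⇝ ε 0<ε =
    let e , 0<e , 8e≡ε = eighth ε 0<ε
        N , h = reciprocal-null e 0<e
        hN = h N ℕP.≤-refl
    in index N , λ p r → ≼-trans
         (∣∣-triangle-≼ (fromℚ (q N)) {q = (e ℚ.+ e) ℚ.+ (e ℚ.+ e)}
             (≼-trans (q-close N p r) (fromℚ-≼ (ℚP.+-mono-≤ hN hN)))
           (ev≼ (N , λ n N≤n → ℚP.≤-trans (q-diff N n)
             (ℚP.+-mono-≤ (ℚP.+-mono-≤ hN hN) (ℚP.+-mono-≤ (h n N≤n) (h n N≤n))))))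
         (fromℚ-≼ (ℚP.<⇒≤ (≡.subst₂ ℚ._<_ (ℚP.+-identityʳ _)
             (≡.trans (solve 1 (λ e → e :+ e :+ (e :+ e :+ (e :+ e)) :+ (e :+ e) := con (+ 8 ℚ./ 1) :* e) ≡.refl e) 8e≡ε)
             (ℚP.+-monoʳ-< (e ℚ.+ e ℚ.+ (e ℚ.+ e ℚ.+ (e ℚ.+ e))) (ℚP.+-mono-< 0<e 0<e)))))
    where open +-*-Solver

⇝-≼ : ∀ {x y z} → x ⇝ y → (∀ p → x p ≼ z) → y ≼ z
⇝-≼ {x} {y} {z} x⇝y h = ≼-limit λ ε 0<ε → let N , h′ = x⇝y ε 0<ε in
  ≼-trans (∣∣≼⇒≼ (∣∣-swap {x N} {y} (h′ N ℕP.≤-refl))) (+-mono-≼ (h N) ≼-refl)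

≼-⇝ : ∀ {x y z} → x ⇝ y → (∀ p → z ≼ x p) → z ≼ y
≼-⇝ {x} {y} {z} x⇝y h = ≼-limit λ ε 0<ε → let N , h′ = x⇝y ε 0<ε in
  ≼-trans (h N) (∣∣≼⇒≼ (h′ N ℕP.≤-refl))

⇝-+ : ∀ {x x′ y y′} → x ⇝ y → x′ ⇝ y′ → (λ p → x p + x′ p) ⇝ (y + y′)
⇝-+ {x} {x′} {y} {y′} h h′ ε 0<ε =
  let N₁ , h₁ = h (ℚ.½ ℚ.* ε) (half 0<ε)
      N₂ , h₂ = h′ (ℚ.½ ℚ.* ε) (half 0<ε)
  in N₁ ℕ.⊔ N₂ , λ p r → ≼-trans
       (pw≼ λ l → subst (λ a → ℚ.∣ a ∣ ℚ.≤ seq (∣ x p - y ∣ + ∣ x′ p - y′ ∣) l)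
         (solve 4 (λ a b c d → (a :- b) :+ (c :- d) := (a :+ c) :- (b :+ d))
             ≡.refl (seq (x p) l) (seq y l) (seq (x′ p) l) (seq y′ l))
         (ℚP.∣p+q∣≤∣p∣+∣q∣ (seq (x p) l ℚ.- seq y l) (seq (x′ p) l ℚ.- seq y′ l)))
       (≼-trans (+-mono-≼ (h₁ p (⊔ˡ N₁ N₂ r)) (h₂ p (⊔ʳ N₁ N₂ r))) (pw≼ λ _ → ℚP.≤-reflexive (halves ε)))
  where open +-*-Solver

⇝-* : ∀ {x y} c → x ⇝ y → (λ p → c * x p) ⇝ (c * y)
⇝-* {x} {y} c h ε 0<ε =
  let K , 0<K , c≼K = rational-upperBound c
      δ , 0<δ , Kδ≡ε = quotient K ε 0<K 0<ε
      N , h′ = h δ 0<δ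
  in N , λ p r → begin
    ∣ c * x p - c * y ∣       ≈⟨ pw≃ (λ l → ≡.trans
                                   (cong ℚ.∣_∣ (solve 3 (λ c x y → c :* x :- c :* y := c :* (x :- y))
                                       ≡.refl (seq c l) (seq (x p) l) (seq y l)))
                                   (ℚP.∣p*q∣≡∣p∣*∣q∣ (seq c l) (seq (x p) l ℚ.- seq y l))) ⟩
    ∣ c ∣ * ∣ x p - y ∣       ≤⟨ *-monoˡ-≼ (pw≼ λ l → ℚP.0≤∣p∣ (seq c l)) (h′ p r) ⟩
    ∣ c ∣ * fromℚ δ           ≈⟨ *-comm ∣ c ∣ (fromℚ δ) ⟩
    fromℚ δ * ∣ c ∣           ≤⟨ *-monoˡ-≼ (fromℚ-≼ (ℚP.<⇒≤ 0<δ)) c≼K ⟩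
    fromℚ δ * fromℚ K         ≈⟨ pw≃ (λ _ → ≡.trans (ℚP.*-comm δ K) Kδ≡ε) ⟩
    fromℚ ε                   ∎
  where open +-*-Solver

⇝-sum : ∀ {n} {x : ℕ → Vector ℝ n} {y : Vector ℝ n} → (∀ k → (λ p → x p k) ⇝ y k) → (λ p → sum (x p)) ⇝ sum y
⇝-sum {zero} h ε 0<ε = 0 , λ _ _ → pw≼ λ _ → ℚP.<⇒≤ 0<ε
⇝-sum {suc n} {x} h = ⇝-+ (h Fin.zero) (⇝-sum {n} {λ p → x p ∘ Fin.suc} (λ k → h (Fin.suc k)))

-- The gap `δ` carried by `0 < y` is split in three: `δ/2` bounds `x`, `δ/4` absorbs the tolerance
-- in `_≼_`, and `δ/4` witnesses strictness.
rational-below : ∀ y → 0ℝ < y → ∃ λ δ → 0ℚ ℚ.< δ × (∀ x → x ≼ fromℚ δ → x < y)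
rational-below y (δ , 0<δ , N , δ<y) = q , half 0<δ , λ x (mk≼ h) →
  let N′ , x<q+r = h r (half (half 0<δ)) in
  r , half (half 0<δ) , N ℕ.⊔ N′ , λ n p → ℚP.<-trans
    (subst (seq x n ℚ.+ r ℚ.<_) q+r+r≡δ (ℚP.+-monoˡ-< r (x<q+r n (⊔ʳ N N′ p))))
    (δ<y n (⊔ˡ N N′ p))
  where
  open +-*-Solver
  q r : ℚ
  q = ℚ.½ ℚ.* δ
  r = ℚ.½ ℚ.* q
  q+r+r≡δ : q ℚ.+ r ℚ.+ r ≡ 0ℚ ℚ.+ δ
  q+r+r≡δ = solve 1 (λ δ → con ℚ.½ :* δ :+ con ℚ.½ :* (con ℚ.½ :* δ) :+ con ℚ.½ :* (con ℚ.½ :* δ) := con 0ℚ :+ δ) ≡.refl δ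

-- Convergence of runs

square-mono-≼ : ∀ {h x} → 0ℚ ℚ.≤ h → fromℚ h ≼ x → fromℚ (h ℚ.* h) ≼ x * x
square-mono-≼ {h} {x} 0≤h h≼x = ≼-from
  (0≼* (≼⇒0≼ h≼x) (0≼+ (≼-trans (fromℚ-≼ 0≤h) h≼x) (fromℚ-≼ 0≤h)))
  λ l → solve 2 (λ h x → h :* h :+ (x :- h) :* (x :+ h) := x :* x) ≡.refl h (seq x l)
  where open +-*-Solver

module _ (G : Graph) where

  -- The remainder of the Taylor expansion is nonnegative. This inequality stands in for continuity
  -- of `f` in `w⋆-minimal`.
  tangent≼ : ∀ v w → f G w + 2ℝ * dot (λ k → v k - w k) (M₂ G · w) ≼ f G v
  tangent≼ v w = ≼-resp ≃-refl (≃-sym (quadraticForm-polar (M₂ G) (M₂-symmetric G) v w))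
    (≼-from (≼-trans (0≼* (0≼fromℕ 2) (0≼dot d)) (M₂-lowerBound G d)) λ _ → ≡.refl)
    where
    d : Vector ℝ (size G)
    d k = v k - w k

  module Run (w : ℕ → Vector ℝ (size G)) (w0≋𝟏 : w 0 ≋ 𝟏) (steps : ∀ n → Step G (w n) (w (suc n))) where

    iₙ jₙ : ℕ → E G
    iₙ n = proj₁ (steps n)
    jₙ n = proj₁ (proj₂ (proj₂ (steps n)))

    iₙ-min : ∀ n k → (M₂ G · w n) (iₙ n) ≼ (M₂ G · w n) k
    iₙ-min n k = mk≼ (proj₁ (proj₂ (steps n)) k)

    jₙ-max : ∀ n k → η G (w n) (iₙ n) k ≼ η G (w n) (iₙ n) (jₙ n)
    jₙ-max n k = mk≼ (proj₁ (proj₂ (proj₂ (proj₂ (steps n)))) k)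

    sₙ : ℕ → ℝ
    sₙ n = η G (w n) (iₙ n) (jₙ n)

    wₙ₊₁ : ∀ n k → w (suc n) k ≃ w n k + exchange (sₙ n) (iₙ n) (jₙ n) k
    wₙ₊₁ n k = mk≃ (proj₂ (proj₂ (proj₂ (proj₂ (steps n)))) k)

    feasible : ∀ n → Feasible G (w n)
    feasible zero = record
      { total = ≃-trans (sum-cong-≋ λ k → mk≃ (w0≋𝟏 k)) (sum-𝟏 (size G))
      ; 0≼ = λ k → ≼-resp ≃-refl (≃-sym (mk≃ (w0≋𝟏 k))) (fromℚ-≼ (ℚP.nonNegative⁻¹ 1ℚ)) }
    feasible (suc n) = feasible-step G (feasible n) (iₙ n) (iₙ-min n) (jₙ n) (jₙ-max n) (wₙ₊₁ n)

    f-descent : ∀ n → f G (w (suc n)) + sₙ n * sₙ n ≼ f G (w n)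
    f-descent n = descent G (feasible n) (iₙ n) (iₙ-min n) (jₙ n) (jₙ-max n) (wₙ₊₁ n)

    0≼sₙ : ∀ n → 0ℝ ≼ sₙ n
    0≼sₙ n = 0≼η G (feasible n) (iₙ n) (iₙ-min n) (jₙ n) (jₙ-max n)

    f-decreasing : ∀ {n p} → n ℕ.≤ p → f G (w p) ≼ f G (w n)
    f-decreasing {n} n≤p = go (ℕP.≤⇒≤′ n≤p)
      where
      go : ∀ {p} → n ℕ.≤′ p → f G (w p) ≼ f G (w n)
      go (ℕ.≤′-reflexive ≡.refl) = ≼-refl
      go (ℕ.≤′-step {p} h) = ≼-trans (≼-trans (≼-from (0≼sq (sₙ p)) λ _ → ≡.refl) (f-descent p)) (go h)

    0≼f : ∀ v → 0ℝ ≼ f G v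
    0≼f v = ≼-trans (0≼* (0≼fromℕ 2) (0≼dot v)) (M₂-lowerBound G v)

    small-step : ∀ σ → 0ℚ ℚ.< σ → ∃ λ n → sₙ n ≼ fromℚ σ
    -- The alternative to `s ≤ σ` that can be decided is `s ≥ σ/2`, which costs `f` at least
    -- `(σ/2)²`.
    small-step σ 0<σ = find (λ n → f G (w n)) (λ n → sₙ n ≼ fromℚ σ) (h ℚ.* h)
      (0<* (half 0<σ) (half 0<σ))
      (λ n → 0≼f (w n)) step
      where
      h : ℚ
      h = ℚ.½ ℚ.* σ
      step : ∀ n → sₙ n ≼ fromℚ σ ⊎ f G (w (suc n)) + fromℚ (h ℚ.* h) ≼ f G (w n)
      step n = map₂ (λ h≼s → ≼-trans
        (+-mono-≼ (≼-refl {f G (w (suc n))}) (square-mono-≼ (ℚP.<⇒≤ (half 0<σ)) h≼s))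
        (f-descent n)) (small-or-large (sₙ n) σ 0<σ)

    -- One index serves all feasible `v`, so it applies alike to iterates, to their limit and to
    -- competing minimizers.
    nearly-optimal : ∀ δ → 0ℚ ℚ.< δ → ∃ λ n → ∀ v → Feasible G v →
      dot (λ k → v k - w n k) (λ k → v k - w n k) ≼ f G v - f G (w n) + fromℚ δ
    nearly-optimal δ 0<δ =
      let σ , 0<σ , Kσ≡δ = quotient K δ 0<K 0<δ
          n , s≼σ = small-step σ 0<σ
      in n , λ v Fv → ≼-trans (distance≼ G (feasible n) (iₙ n) (iₙ-min n) (jₙ n) (jₙ-max n) Fv)
           (+-mono-≼ (≼-refl {f G v - f G (w n)})
             (≼-from (0≼+ (0≼* (fromℚ-≼ (ℚP.<⇒≤ 0<K)) (≼⇒0≼ s≼σ)) (0≼sₙ n)) λ l → ≡.trans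
               (solve 3 (λ s σ m →
                   con (+ 16 ℚ./ 1) :* (s :* (m :* m :+ m))
                     :+ ((con 1ℚ :+ con (+ 16 ℚ./ 1) :* (m :* m :+ m)) :* (σ :- s) :+ s)
                   := (con 1ℚ :+ con (+ 16 ℚ./ 1) :* (m :* m :+ m)) :* σ) ≡.refl
                 (seq (sₙ n) l) σ (natℚ (size G)))
               Kσ≡δ))
      where
      open +-*-Solver
      -- The factor of `s` in `distance≼`, increased by 1 so that it is positive and can be divided
      -- by.
      K : ℚ
      K = 1ℚ ℚ.+ (+ 16 ℚ./ 1) ℚ.* (natℚ (size G) ℚ.* natℚ (size G) ℚ.+ natℚ (size G))
      0<K : 0ℚ ℚ.< K
      0<K = ℚP.+-mono-<-≤ (ℚP.positive⁻¹ 1ℚ) (fromℚ-cancel-≼ (≼-trans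
        (0≼* (0≼fromℕ 16) (0≼+ (0≼* (0≼fromℕ (size G)) (0≼fromℕ (size G))) (0≼fromℕ (size G))))
        (pw≼ λ _ → ℚP.≤-refl)))

    near : ∀ ε → 0ℚ ℚ.< ε → ∃ λ n → ∀ v → Feasible G v → f G v ≼ f G (w n) → ∀ k → ∣ v k - w n k ∣ ≼ fromℚ ε
    near ε 0<ε =
      let n , h = nearly-optimal (ε ℚ.* ε) (0<* 0<ε 0<ε)
      in n , λ v Fv fv≼ k → sq≼⇒∣∣≼ 0<ε (begin
        (v k - w n k) * (v k - w n k)
          ≤⟨ term≼sum (λ l → 0≼sq (v l - w n l)) k ⟩
        dot (λ k → v k - w n k) (λ k → v k - w n k)                       ≤⟨ h v Fv ⟩
        f G v - f G (w n) + fromℚ (ε ℚ.* ε)                               ≤⟨ ≼-from (≼⇒0≼ fv≼) (λ l →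
           solve 3 (λ a b c → (a :- b :+ c) :+ (b :- a) := c)
               ≡.refl (seq (f G v) l) (seq (f G (w n)) l) (ε ℚ.* ε)) ⟩
        fromℚ (ε ℚ.* ε)                                                   ∎)
      where open +-*-Solver

    coordinate-cauchy : ∀ k ε → 0ℚ ℚ.< ε → ∃ λ n → ∀ p → n ℕ.≤ p → ∣ w p k - w n k ∣ ≼ fromℚ ε
    coordinate-cauchy k ε 0<ε = let n , h = near ε 0<ε in
      n , λ p n≤p → h (w p) (feasible p) (f-decreasing n≤p) k

    module Coordinate (k : E G) = Completeness (λ p → w p k) (coordinate-cauchy k)

    w⋆ : Vector ℝ (size G)
    w⋆ = Coordinate.limit

    w⇝w⋆ : ∀ k → (λ p → w p k) ⇝ w⋆ k
    w⇝w⋆ = Coordinate.limit-⇝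

    feasible⋆ : Feasible G w⋆
    feasible⋆ = record
      { total = ≼-antisym (⇝-≼ Σw⇝Σw⋆ λ p → ≃⇒≼ (total (feasible p)))
                          (≼-⇝ Σw⇝Σw⋆ λ p → ≃⇒≼ (≃-sym (total (feasible p))))
      ; 0≼ = λ k → ≼-⇝ (w⇝w⋆ k) λ p → 0≼ (feasible p) k }
      where
      Σw⇝Σw⋆ : (λ p → sum (w p)) ⇝ sum w⋆
      Σw⇝Σw⋆ = ⇝-sum w⇝w⋆

    g⋆ : Vector ℝ (size G)
    g⋆ = M₂ G · w⋆

    slope⇝ : (λ p → dot g⋆ (w p)) ⇝ dot g⋆ w⋆
    slope⇝ = ⇝-sum λ k → ⇝-* (g⋆ k) (w⇝w⋆ k)

    -- By the tangent at `w⋆`, `f w⋆` exceeds `f (w p)` by at most `2 |g⋆·(w p - w⋆)|`, so only a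
    -- fixed linear functional has to converge. On the other side `nearly-optimal` gives
    -- `f (w n) ≤ f v + ε/2`, as the squared distance is nonnegative.
    w⋆-minimal : ∀ v → Feasible G v → f G w⋆ ≼ f G v
    w⋆-minimal v Fv = ≼-limit λ ε 0<ε →
      -- The slope enters twice, so `ε/4` for it uses one half of `ε`; near-optimality uses the
      -- other.
      let e = ℚ.½ ℚ.* (ℚ.½ ℚ.* ε)
          n , h = nearly-optimal (ℚ.½ ℚ.* ε) (half 0<ε)
          N , h′ = slope⇝ e (half (half 0<ε))
          p = n ℕ.⊔ N
          d = λ k → w p k - w⋆ k
      in begin
        f G w⋆
          ≤⟨ ≼-from (0≼+ (≼⇒0≼ (tangent≼ (w p) w⋆)) (0≼* (0≼fromℕ 2) (≼⇒0≼ (slope-bound p (h′ p (ℕP.m≤n⊔m n N)))))) (λ l →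
               ≡.trans (solve 4 (λ a b c e →
                   a :+ ((b :- (a :+ con (+ 2 ℚ./ 1) :* c)) :+ con (+ 2 ℚ./ 1) :* (c :- (:- e))) := b :+ (e :+ e)) ≡.refl
                         (seq (f G w⋆) l) (seq (f G (w p)) l) (seq (dot d g⋆) l) e)
                       (cong (seq (f G (w p)) l ℚ.+_) (halves (ℚ.½ ℚ.* ε)))) ⟩
        f G (w p) + fromℚ (ℚ.½ ℚ.* ε)
          ≤⟨ +-mono-≼ (f-decreasing (ℕP.m≤m⊔n n N)) ≼-refl ⟩
        f G (w n) + fromℚ (ℚ.½ ℚ.* ε)
          ≤⟨ ≼-from (≼-trans (0≼dot (λ k → v k - w n k)) (h v Fv)) (λ l → ≡.trans
               (solve 3 (λ a b e → (a :+ e) :+ (b :- a :+ e) := b :+ (e :+ e))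
                   ≡.refl (seq (f G (w n)) l) (seq (f G v) l) (ℚ.½ ℚ.* ε))
               (cong (seq (f G v) l ℚ.+_) (halves ε))) ⟩
        f G v + fromℚ ε ∎
      where
      open +-*-Solver
      slope-bound : ∀ p {e} → ∣ dot g⋆ (w p) - dot g⋆ w⋆ ∣ ≼ fromℚ e → - fromℚ e ≼ dot (λ k → w p k - w⋆ k) g⋆
      slope-bound p {e} h = ≼-resp ≃-refl
        (≃-sym (≃-trans (dot-comm (λ k → w p k - w⋆ k) g⋆) (dot-‿-ʳ g⋆ (w p) w⋆)))
        (≼-from (≼⇒0≼ (∣∣≼⇒≼ (∣∣-swap {dot g⋆ (w p)} {dot g⋆ w⋆} h))) λ l →
          solve 3 (λ a b e → (:- e) :+ (a :+ e :- b) := a :- b)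
              ≡.refl (seq (dot g⋆ (w p)) l) (seq (dot g⋆ w⋆) l) e)

    -- Both minimizers have value at most `f (w n)`, so both lie within `ε/2` of the same iterate.
    w⋆-unique : ∀ v → Feasible G v → (∀ u → Feasible G u → f G v ≼ f G u) → ∀ k → v k ≃ w⋆ k
    w⋆-unique v Fv v-min k = ∣∣≼⇒≃ λ ε 0<ε →
      let n , h = near (ℚ.½ ℚ.* ε) (half 0<ε) in ≼-trans
        (∣∣-triangle-≼ (w n k) (h v Fv (v-min (w n) (feasible n)) k)
          (∣∣-swap {w⋆ k} {w n k} (h w⋆ feasible⋆ (w⋆-minimal (w n) (feasible n)) k)))
        (fromℚ-≼ (ℚP.≤-reflexive (halves ε)))

    -- Whereas `w⇝w⋆` has an index for each coordinate, going through `near` again yields one for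
    -- all of them, as the sup norm demands.
    convergence : ∀ ε → 0ℚ ℚ.< ε → ∃ λ N → ∀ p → N ℕ.≤ p → ∀ k → ∣ w p k - w⋆ k ∣ ≼ fromℚ ε
    convergence ε 0<ε =
      let n , h = near (ℚ.½ ℚ.* ε) (half 0<ε) in n , λ p n≤p k → ≼-trans
        (∣∣-triangle-≼ (w n k) (h (w p) (feasible p) (f-decreasing n≤p) k)
          (∣∣-swap {w⋆ k} {w n k} (h w⋆ feasible⋆ (w⋆-minimal (w n) (feasible n)) k)))
        (fromℚ-≼ (ℚP.≤-reflexive (halves ε)))

theorem4p23 : (G : Graph) → 1 ℕ.≤ size G →
    (w : ℕ → Vector ℝ (size G)) → IsRun G w →
    ∃ λ w⋆ → IsMinimizer G w⋆ × (∀ v → IsMinimizer G v → v ≋ w⋆) × (w ⟶ w⋆)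
theorem4p23 G _ w (w0≋𝟏 , steps) =
  w⋆ ,
  (feasible⇒R G feasible⋆ , λ v Rv → get≼ (w⋆-minimal v (R⇒feasible G Rv))) ,
  (λ v (Rv , v-min) k → get≃ (w⋆-unique v (R⇒feasible G Rv) (λ u Fu → mk≼ (v-min u (feasible⇒R G Fu))) k)) ,
  λ ε 0<ε →
    let δ , 0<δ , below = rational-below ε 0<ε
        N , h = convergence δ 0<δ
    in N , λ n N≤n k → below _ (h n N≤n k)
  where
  open Run G w w0≋𝟏 steps
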